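{- $[\llcorner]\subsetneq[\llcorner,\urcorner]\subsetneq \text{Helly- }B_1\text{ -EPG}$, and the class Helly-$B_1$-EPG is incomparable (under inclusion) with each of the classes $[\llcorner,\ulcorner]$ and $[\llcorner,\ulcorner,\urcorner]$.
   Context: A grid is the set of integer points of the plane; a grid edge joins two grid points at distance $1$. A path in the grid is a sequence of distinct grid edges in which consecutive edges share exactly one grid point and non-consecutive edges share none; a bend is a pair of consecutive edges with different directions (horizontal/vertical). An EPG representation of a graph $G$ is a family $(P_v)_{v\in V(G)}$ of grid paths such that distinct $u,v$ are adjacent iff $P_u,P_v$ share a grid edge; it is $B_1$-EPG if every path has at most one bend, and is Helly if every subfamily of pairwise edge-intersecting paths has a grid edge common to all its members. Helly-$B_1$-EPG is the class of graphs admitting a Helly $B_1$-EPG representation. A one-bend path has one of the four shapes $\llcorner,\lrcorner,\ulcorner,\urcorner$ (according to which two directions leave its bend point). For $S\subseteq\{\llcorner,\lrcorner,\ulcorner,\urcorner\}$, $[S]$ denotes the class of graphs having a $B_1$-EPG representation in which every path has a shape in $S$, where paths with no bend are regarded as degenerate $\llcorner$'s. -}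

module Defs where

open import Data.Nat using (ℕ; suc; _<_)
open import Data.Integer using (ℤ) renaming (suc to 1+_; pred to -1+_)
open import Data.Fin using (Fin; toℕ; inject₁) renaming (suc to fsuc)
open import Data.Fin.Subset using (Subset; _∈_)
open import Data.Product using (_×_; _,_; ∃; ∃-syntax)
open import Data.Sum using (_⊎_)
open import Function.Bundles using (_⇔_)
open import Function.Definitions using (Injective)
open import Level using (0ℓ)
open import Relation.Binary.Core using (Rel)
open import Relation.Binary.Definitions using (Decidable; Irreflexive; Symmetric)
open import Relation.Binary.PropositionalEquality using (_≡_; _≢_)
open import Relation.Nullary using (¬_)
open import Relation.Unary using (Pred; _⊈_)

record Graph : Set₁ where
  field
    order  : ℕ
    Adj    : Rel (Fin order) 0ℓ
    sym    : Symmetric Adj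
    irrefl : Irreflexive _≡_ Adj
    adj?   : Decidable Adj

  Vertex : Set
  Vertex = Fin order

Point : Set
Point = ℤ × ℤ

data Direction : Set where
  horizontal vertical : Direction

-- An (undirected) grid edge is determined by its direction and by its left
-- (if horizontal) or lower (if vertical) endpoint, so propositional equality
-- of this record is equality of edges as unordered pairs of points.

record GridEdge : Set where
  constructor edge
  field
    origin    : Point
    direction : Direction

open GridEdge public

target : GridEdge → Point
target (edge (x , y) horizontal) = 1+ x , y
target (edge (x , y) vertical)   = x , 1+ y

_endpointOf_ : Point → GridEdge → Set
p endpointOf e = p ≡ origin e ⊎ p ≡ target e

_commonTo_and_ : Point → GridEdge → GridEdge → Set
p commonTo e and f = p endpointOf e × p endpointOf f

ShareExactlyOnePoint : Rel GridEdge 0ℓ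
ShareExactlyOnePoint e f =
  ∃[ p ] (p commonTo e and f × (∀ q → q commonTo e and f → q ≡ p))

ShareNoPoint : Rel GridEdge 0ℓ
ShareNoPoint e f = ∀ p → ¬ (p commonTo e and f)

-- A path has at least one edge: its edges are indexed by Fin (suc joints),
-- and its pairs of consecutive edges by Fin joints.

record Path : Set where
  field
    joints         : ℕ
    edgeAt         : Fin (suc joints) → GridEdge
    distinct       : Injective _≡_ _≡_ edgeAt
    consecutive    : ∀ i → ShareExactlyOnePoint (edgeAt (inject₁ i)) (edgeAt (fsuc i))
    nonconsecutive : ∀ i j → suc (toℕ i) < toℕ j → ShareNoPoint (edgeAt i) (edgeAt j)

  before after : Fin joints → GridEdge
  before i = edgeAt (inject₁ i)
  after  i = edgeAt (fsuc i)

  IsBend : Pred (Fin joints) 0ℓ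
  IsBend i = direction (before i) ≢ direction (after i)

  AtMostOneBend : Set
  AtMostOneBend = ∀ i j → IsBend i → IsBend j → i ≡ j

_∈ₚ_ : GridEdge → Path → Set
e ∈ₚ P = ∃[ i ] Path.edgeAt P i ≡ e

ShareEdge : Rel Path 0ℓ
ShareEdge P Q = ∃[ e ] (e ∈ₚ P × e ∈ₚ Q)

data Shape : Set where
  ⌞ ⌟ ⌜ ⌝ : Shape

data Heading : Set where
  left right down up : Heading

leaving : Point → Heading → GridEdge
leaving (x , y) left  = edge (-1+ x , y) horizontal
leaving (x , y) right = edge (x , y) horizontal
leaving (x , y) down  = edge (x , -1+ y) vertical
leaving (x , y) up    = edge (x , y) vertical

horizontalArm verticalArm : Shape → Heading
horizontalArm ⌞ = right
horizontalArm ⌟ = left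
horizontalArm ⌜ = right
horizontalArm ⌝ = left
verticalArm ⌞ = up
verticalArm ⌟ = up
verticalArm ⌜ = down
verticalArm ⌝ = down

-- The witness p is necessarily the point shared by the two edges.  Both orders
-- occur because paths are sequences while shapes do not depend on orientation.
BendHasShape : (P : Path) → Fin (Path.joints P) → Shape → Set
BendHasShape P i s = ∃[ p ]
  ( (before i ≡ leaving p (horizontalArm s) × after i ≡ leaving p (verticalArm s))
  ⊎ (before i ≡ leaving p (verticalArm s) × after i ≡ leaving p (horizontalArm s)))
  where open Path P

-- Meant for paths with at most one bend; those without a bend are degenerate ⌞'s.
_HasShape_ : Path → Shape → Set
P HasShape s =
    ((∀ i → ¬ Path.IsBend P i) × s ≡ ⌞)
  ⊎ (∃[ i ] (Path.IsBend P i × BendHasShape P i s))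

record EPG (G : Graph) : Set where
  open Graph G
  field
    path      : Vertex → Path
    adjacency : ∀ u v → u ≢ v → Adj u v ⇔ ShareEdge (path u) (path v)

  B₁ : Set
  B₁ = ∀ v → Path.AtMostOneBend (path v)

  Helly : Set
  Helly = ∀ (F : Subset order) →
          (∀ u v → u ∈ F → v ∈ F → u ≢ v → ShareEdge (path u) (path v)) →
          ∃[ e ] (∀ u → u ∈ F → e ∈ₚ path u)

  ShapesIn : Pred Shape 0ℓ → Set
  ShapesIn S = ∀ v → ∃[ s ] (S s × path v HasShape s)

Helly-B₁-EPG : Pred Graph 0ℓ
Helly-B₁-EPG G = ∃[ R ] (EPG.B₁ {G} R × EPG.Helly R)

B₁-EPG[_] : Pred Shape 0ℓ → Pred Graph 0ℓ
B₁-EPG[ S ] G = ∃[ R ] (EPG.B₁ {G} R × EPG.ShapesIn R S)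

Incomparable : Pred Graph 0ℓ → Pred Graph 0ℓ → Set₁
Incomparable C D = C ⊈ D × D ⊈ C

{-# OPTIONS --safe #-}
module Submission where

open import Data.Bool using (Bool; true; false)
open import Data.Empty using (⊥; ⊥-elim)
open import Data.Fin as Fin using (Fin; zero; suc; toℕ; inject₁; fromℕ<; #_)
import Data.Fin.Properties as Fin
open import Data.Fin.Subset using (Subset; inside; outside; _∈_)
open import Data.Fin.Subset.Properties using (_∈?_)
open import Data.Integer as ℤ using (ℤ; 0ℤ; 1ℤ; -1ℤ)
import Data.Integer.Properties as ℤ
open import Data.Nat as ℕ using (ℕ; zero; suc; s≤s; z≤n; _∸_)
import Data.Nat.Properties as ℕ
open import Data.Product using (_×_; _,_; proj₁; proj₂; ∃; ∃-syntax; ∃₂)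
open import Data.Product.Properties using (≡-dec)
open import Data.Sum using (_⊎_; inj₁; inj₂; [_,_]′)
open import Data.Unit using (⊤)
open import Data.Vec using (Vec; lookup; []; _∷_; here; there)
open import Function using (_∘_; id; mk⇔; Equivalence)
open import Level using (0ℓ)
open import Relation.Binary.PropositionalEquality
open import Relation.Nullary using (¬_; Dec; yes; no; contradiction; does)
open import Relation.Nullary.Decidable
  using (True; toWitness; from-yes; map′; ¬?; _×-dec_; _⊎-dec_; _→-dec_)
open import Relation.Unary using (Pred; _⊆_; _⊂_; _∩_; _∪_; ｛_｝)
open import Defs

-- All paths with at most one bend are hooks: one line per direction, convex, and with a
-- definite shape wherever both directions occur.
--
-- If the shapes allowed at each point are equal or opposite, no three hooks form a
-- claw; such hooks are closed under intersection and satisfy the Helly property for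
-- triples, hence for all finite families.
--
-- The 3-sun has no Helly representation: three pairwise intersections of paths through a
-- common edge would have to leave it by three different ends.
--
-- Let A and B be disjoint, and C range over pairwise disjoint hooks meeting both.  If C
-- meets A and B in the same direction, all the others meet both in the other direction.
-- So as soon as there are three of them, each C bends where the line of A in one direction
-- crosses the line of B in the other, and those bending at one point have opposite
-- shapes.  Hence K₂,₃ is not representable by ⌞ alone.  In a K₂,₄ two of the C's bend at
-- each of the two crossings, and paths joining A, respectively B, to a pair of C's at
-- different crossings turn the arms of that pair inwards: together with A and B it forms
-- the corners of a rectangle, which uses all four shapes.

-- Directions, sides and edges in coordinates

data Side : Set where
  lower upper : Side

opposite : Side → Side
opposite lower = upper
opposite upper = lower

flip : Direction → Direction
flip horizontal = vertical
flip vertical   = horizontal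

-- Coordinates relative to a direction: `l` names the line and `a` the position along it, so one
-- argument serves both directions.
point : Direction → ℤ → ℤ → Point
point horizontal l a = a , l
point vertical   l a = l , a

at : Direction → ℤ → ℤ → GridEdge
at d l a = edge (point d l a) d

along across : Direction → Point → ℤ
along horizontal (x , _) = x
along vertical   (_ , y) = y
across horizontal (_ , y) = y
across vertical   (x , _) = x

-- Edges are named by their lower coordinate, so the two edges of a line that meet
-- at coordinate c are numbered pred c and c.
near : Side → ℤ → ℤ
near lower = ℤ.pred
near upper c = c

spoke : Point → Direction → Side → GridEdge
spoke p d σ = at d (across d p) (near σ (along d p))

arm : Shape → Direction → Side
arm ⌞ _          = upper
arm ⌝ _          = lower
arm ⌟ horizontal = lower
arm ⌟ vertical   = upper
arm ⌜ horizontal = upper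
arm ⌜ vertical   = lower

is-⌟ : ∀ s → arm s horizontal ≡ lower → arm s vertical ≡ upper → s ≡ ⌟
is-⌟ ⌟ _ _ = refl

at-injective : ∀ {d d′ l l′ a a′} → at d l a ≡ at d′ l′ a′ → d ≡ d′ × l ≡ l′ × a ≡ a′
at-injective {horizontal} {horizontal} refl = refl , refl , refl
at-injective {vertical}   {vertical}   refl = refl , refl , refl

point-injective : ∀ d {l l′ a a′} → point d l a ≡ point d l′ a′ → l ≡ l′ × a ≡ a′
point-injective horizontal refl = refl , refl
point-injective vertical   refl = refl , refl

edge-at : ∀ d e → (∃₂ λ l a → e ≡ at d l a) ⊎ (∃₂ λ l a → e ≡ at (flip d) l a)
edge-at horizontal (edge (x , y) horizontal) = inj₁ (y , x , refl)
edge-at horizontal (edge (x , y) vertical)   = inj₂ (x , y , refl)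
edge-at vertical   (edge (x , y) horizontal) = inj₂ (y , x , refl)
edge-at vertical   (edge (x , y) vertical)   = inj₁ (x , y , refl)

as-at : ∀ e → ∃₂ λ l a → e ≡ at (direction e) l a
as-at (edge (x , y) horizontal) = y , x , refl
as-at (edge (x , y) vertical)   = x , y , refl

d≢flip : ∀ d → d ≢ flip d
d≢flip horizontal ()
d≢flip vertical   ()

-- Reading a line towards one of its two ends

infix 4 _≼[_]_

_≼[_]_ : ℤ → Side → ℤ → Set
a ≼[ upper ] b = a ℤ.≤ b
a ≼[ lower ] b = b ℤ.≤ a

≼-refl : ∀ σ {a} → a ≼[ σ ] a
≼-refl lower = ℤ.≤-refl
≼-refl upper = ℤ.≤-refl

≼-trans : ∀ σ {a b c} → a ≼[ σ ] b → b ≼[ σ ] c → a ≼[ σ ] c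
≼-trans lower p q = ℤ.≤-trans q p
≼-trans upper p q = ℤ.≤-trans p q

≼-antisym : ∀ σ {a b} → a ≼[ σ ] b → b ≼[ σ ] a → a ≡ b
≼-antisym lower p q = ℤ.≤-antisym q p
≼-antisym upper p q = ℤ.≤-antisym p q

≼-total : ∀ σ a b → a ≼[ σ ] b ⊎ b ≼[ σ ] a
≼-total lower a b = ℤ.≤-total b a
≼-total upper a b = ℤ.≤-total a b

≼-opposite : ∀ σ {a b} → a ≼[ σ ] b → b ≼[ opposite σ ] a
≼-opposite lower p = p
≼-opposite upper p = p

≼-opposite⁻¹ : ∀ σ {a b} → a ≼[ opposite σ ] b → b ≼[ σ ] a
≼-opposite⁻¹ lower p = p
≼-opposite⁻¹ upper p = p

near-opposite≼near : ∀ σ l → near (opposite σ) l ≼[ σ ] near σ l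
near-opposite≼near lower l = ℤ.<⇒≤ (ℤ.i≤pred[j]⇒i<j ℤ.≤-refl)
near-opposite≼near upper l = ℤ.<⇒≤ (ℤ.i≤pred[j]⇒i<j ℤ.≤-refl)

-- The two edges meeting at coordinate `l` have consecutive numbers, so no edge of the line lies
-- strictly between them.
beyond⊎behind : ∀ σ l a → near σ l ≼[ σ ] a ⊎ a ≼[ σ ] near (opposite σ) l
beyond⊎behind lower l a with l ℤ.≤? a
... | yes l≤a = inj₂ l≤a
... | no  l≰a = inj₁ (ℤ.i<j⇒i≤pred[j] (ℤ.≰⇒> l≰a))
beyond⊎behind upper l a with l ℤ.≤? a
... | yes l≤a = inj₁ l≤a
... | no  l≰a = inj₂ (ℤ.i<j⇒i≤pred[j] (ℤ.≰⇒> l≰a))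

side-unique : ∀ σ τ {l a} → near σ l ≼[ σ ] a → near τ l ≼[ τ ] a → σ ≡ τ
side-unique lower lower _ _ = refl
side-unique lower upper p q = contradiction q (ℤ.<⇒≱ (ℤ.i≤pred[j]⇒i<j p))
side-unique upper lower p q = contradiction p (ℤ.<⇒≱ (ℤ.i≤pred[j]⇒i<j q))
side-unique upper upper _ _ = refl

side≢opposite : ∀ σ → σ ≢ opposite σ
side≢opposite lower ()
side≢opposite upper ()

not-both : ∀ σ {l a} → near σ l ≼[ σ ] a → ¬ a ≼[ σ ] near (opposite σ) l
not-both σ p q = side≢opposite σ (side-unique σ (opposite σ) p (≼-opposite σ q))

≢⇒opposite : ∀ {σ τ} → σ ≢ τ → τ ≡ opposite σ
≢⇒opposite {lower} {lower} ne = contradiction refl ne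
≢⇒opposite {lower} {upper}  _  = refl
≢⇒opposite {upper}  {lower} _  = refl
≢⇒opposite {upper}  {upper}  ne = contradiction refl ne

same⊎opposite : ∀ σ τ → τ ≡ σ ⊎ τ ≡ opposite σ
same⊎opposite lower lower = inj₁ refl
same⊎opposite lower upper = inj₂ refl
same⊎opposite upper lower = inj₂ refl
same⊎opposite upper upper = inj₁ refl

pigeonhole : (σ τ ρ : Side) → σ ≡ τ ⊎ (σ ≡ ρ ⊎ τ ≡ ρ)
pigeonhole lower lower _      = inj₁ refl
pigeonhole lower upper lower = inj₂ (inj₁ refl)
pigeonhole lower upper upper = inj₂ (inj₂ refl)
pigeonhole upper lower lower = inj₂ (inj₂ refl)
pigeonhole upper lower upper = inj₂ (inj₁ refl)
pigeonhole upper upper _      = inj₁ refl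

opposite-involutive : ∀ σ → opposite (opposite σ) ≡ σ
opposite-involutive lower = refl
opposite-involutive upper = refl

-- Ends and corners of hooks

record EndsAt (S : Pred GridEdge 0ℓ) (d : Direction) (k : ℤ) (σ : Side) (l : ℤ) : Set where
  constructor ending
  field
    inside∈  : S (at d k (near σ l))
    outside∉ : ¬ S (at d k (near (opposite σ) l))

open EndsAt

-- The edge set of an L-shaped path, or more generally of an intersection of such
-- paths; K p s says that bending at p with shape s is allowed.
record IsHook (K : Point → Shape → Set) (S : Pred GridEdge 0ℓ) : Set where
  field
    line   : ∀ d {k l a b} → S (at d k a) → S (at d l b) → k ≡ l
    convex : ∀ d {k a b c} → S (at d k a) → S (at d k c) → a ℤ.≤ b → b ℤ.≤ c → S (at d k b)
    corner : ∀ d {k l a b} → S (at d k a) → S (at (flip d) l b) →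
             ∃[ s ] (K (point d k l) s × EndsAt S d k (arm s d) l × EndsAt S (flip d) l (arm s (flip d)) k)

  between : ∀ d σ {k a b c} → S (at d k a) → S (at d k c) → a ≼[ σ ] b → b ≼[ σ ] c → S (at d k b)
  between d lower sa sc p q = convex d sc sa q p
  between d upper sa sc p q = convex d sa sc p q

  -- An edge behind the end would, by convexity, bring in the excluded edge at `l` as well.
  beyond : ∀ d σ {k l a} → EndsAt S d k σ l → S (at d k a) → near σ l ≼[ σ ] a
  beyond d σ {k} {l} {a} (ending s ns) sa with beyond⊎behind σ l a
  ... | inj₁ p = p
  ... | inj₂ p = contradiction (between d σ sa s p (near-opposite≼near σ l)) ns

  bend : ∀ d {k l a b} → S (at d k a) → S (at (flip d) l b) → ∃[ σ ] EndsAt S d k σ l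
  bend d sa sb = let s , _ , e , _ = corner d sa sb in arm s d , e

  bend⊥ : ∀ d {k l a b} → S (at d k a) → S (at (flip d) l b) → ∃[ τ ] EndsAt S (flip d) l τ k
  bend⊥ d sa sb = let s , _ , _ , e = corner d sa sb in arm s (flip d) , e

  ends : ∀ d σ {k l a b} → S (at d k a) → S (at (flip d) l b) → near σ l ≼[ σ ] a → EndsAt S d k σ l
  ends d σ {k} {l} sa sb p with bend d sa sb
  ... | τ , e = subst (λ ρ → EndsAt S d k ρ l) (side-unique τ σ (beyond d τ e sa) p) e

  -- `flip (flip d)` does not reduce to `d` for a variable `d`; this transports membership.
  reflip : ∀ d {l a} → S (at d l a) → S (at (flip (flip d)) l a)
  reflip horizontal s = s
  reflip vertical   s = s

  -- Having edges in both directions, the hook starts at its corner `l`, so it contains everything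
  -- from there up to `a`.
  fill : ∀ d σ {k l a b c} → S (at d k a) → S (at (flip d) l b) → near σ l ≼[ σ ] c → c ≼[ σ ] a →
         S (at d k c)
  fill d σ sa sb p q = between d σ (inside∈ (ends d σ sa sb (≼-trans σ p q))) sa p q

open IsHook

weaken : ∀ {K L S} → (∀ {p s} → K p s → L p s) → IsHook K S → IsHook L S
weaken f h = record
  { line = line h
  ; convex = convex h
  ; corner = λ d sa sb → let s , k , es = corner h d sa sb in s , f k , es
  }

Meets : Pred GridEdge 0ℓ → Pred GridEdge 0ℓ → Set
Meets S T = ∃[ e ] (S e × T e)

meets-sym : ∀ {S T} → Meets S T → Meets T S
meets-sym (e , s , t) = e , t , s

-- Hooks through a common edge

-- Which of the two ends of a hook through the edge at d k t the edge f lies towards.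
data Towards (d : Direction) (t : ℤ) (k : ℤ) (σ : Side) : GridEdge → Set where
  same : ∀ {p} → t ≼[ σ ] p → Towards d t k σ (at d k p)
  turn : ∀ {l q} → near (opposite σ) l ≼[ opposite σ ] t → Towards d t k σ (at (flip d) l q)

towards : ∀ {K S} d {k t f} → IsHook K S → S (at d k t) → S f → ∃[ σ ] Towards d t k σ f
towards d {k} {t} {f} h st sf with edge-at d f
... | inj₁ (l , a , refl) with line h d st sf
...   | refl with ≼-total upper t a
...     | inj₁ p = upper , same p
...     | inj₂ p = lower , same p
towards d {k} {t} {f} h st sf | inj₂ (l , a , refl) with bend h d st sf
... | τ , e = opposite τ ,
  turn (subst (λ ρ → near ρ l ≼[ ρ ] t) (sym (opposite-involutive τ)) (beyond h d τ e st))

-- Travelling along `X` from the common edge towards `σ`, one of `f` and `g` is reached first, and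
-- straight edges come before turned ones. The hook sharing the farther one with `X` takes the same
-- route and so contains the nearer one.
clash : ∀ {K X Y Z} d σ {k t f g} → IsHook K X → IsHook K Y → IsHook K Z →
        X (at d k t) → Y (at d k t) → Z (at d k t) → X f → Y f → X g → Z g →
        Towards d t k σ f → Towards d t k σ g → Z f ⊎ Y g
clash d σ hX hY hZ xt yt zt xf yf xg zg (same {p} tp) (same {p′} tp′) with ≼-total σ p p′
... | inj₁ q = inj₁ (between hZ d σ zt zg tp q)
... | inj₂ q = inj₂ (between hY d σ yt yf tp′ q)
clash d σ hX hY hZ xt yt zt xf yf xg zg (same {p} tp) (turn {l} q) =
  inj₁ (between hZ d σ zt (inside∈ (ends hZ d (opposite σ) zt zg q)) tp
         (≼-opposite⁻¹ σ (beyond hX d (opposite σ) (ends hX d (opposite σ) xt xg q) xf)))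
clash d σ hX hY hZ xt yt zt xf yf xg zg (turn {l} q) (same {p} tp) =
  inj₂ (between hY d σ yt (inside∈ (ends hY d (opposite σ) yt yf q)) tp
         (≼-opposite⁻¹ σ (beyond hX d (opposite σ) (ends hX d (opposite σ) xt xf q) xg)))
clash d σ hX hY hZ xt yt zt xf yf xg zg (turn {l} {q} _) (turn {l′} {q′} _)
  with line hX (flip d) xf xg
... | refl with bend⊥ hX d xt xf
...   | τ , e with ≼-total τ q q′
...     | inj₁ r = inj₁ (fill hZ (flip d) τ zg (reflip hZ d zt) (beyond hX (flip d) τ e xf) r)
...     | inj₂ r = inj₂ (fill hY (flip d) τ yf (reflip hY d yt) (beyond hX (flip d) τ e xg) r)

-- Each of `f`, `g`, `h` lies towards one of only two sides of the common edge. Two of them agree,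
-- and `clash`, applied to the hook containing both, puts one of them into the hook that it avoids.
no-sun : ∀ {K X Y Z e f g h} → IsHook K X → IsHook K Y → IsHook K Z →
         X e → Y e → Z e → X f → Y f → ¬ Z f → X g → Z g → ¬ Y g → Y h → Z h → ¬ X h → ⊥
no-sun {e = e} hX hY hZ xe ye ze xf yf nzf xg zg nyg yh zh nxh with as-at e
... | k , t , refl with direction e
... | d with towards d hX xe xf | towards d hX xe xg | towards d hY ye yh
... | σ , f | τ , g | ρ , h with pigeonhole σ τ ρ
... | inj₁ refl        = [ nzf , nyg ]′ (clash d σ hX hY hZ xe ye ze xf yf xg zg f g)
... | inj₂ (inj₁ refl) = [ nzf , nxh ]′ (clash d σ hY hX hZ ye xe ze yf xf yh zh f h)
... | inj₂ (inj₂ refl) = [ nyg , nxh ]′ (clash d τ hZ hX hY ze xe ye zg xg zh yh g h)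

-- Helly families

-- A claw at `p` has one hook straight through `p` and two hooks bending there with one arm in
-- common and the other arms opposite; such a pair of bends is excluded here.
record Clawfree (K : Point → Shape → Set) : Set where
  field unique-arm : ∀ {p s t} d → K p s → K p t → arm s d ≡ arm t d → s ≡ t

open Clawfree

-- Only corners need care: both hooks bend at the same point, and a common edge there forces equal
-- arms, hence by `unique-arm` equal shapes.
∩-isHook : ∀ {K S T} → Clawfree K → IsHook K S → IsHook K T → IsHook K (S ∩ T)
∩-isHook K! hS hT .line d (sa , _) (sb , _) = line hS d sa sb
∩-isHook K! hS hT .convex d (sa , ta) (sc , tc) p q = convex hS d sa sc p q , convex hT d ta tc p q
∩-isHook K! hS hT .corner d (sa , ta) (sb , tb)
  with corner hS d sa sb | corner hT d ta tb
... | s , ks , es , fs | t , kt , et , ft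
  with unique-arm K! d ks kt (side-unique (arm s d) (arm t d) (beyond hS d _ es sa) (beyond hT d _ et ta))
... | refl = s , ks , ending (inside∈ es , inside∈ et) (outside∉ es ∘ proj₁) ,
  ending (inside∈ fs , inside∈ ft) (outside∉ fs ∘ proj₁)

-- The middle one of three edges on a line belongs to all three hooks by convexity.
median : ∀ {K X Y Z d k a b c} → IsHook K X → IsHook K Y → IsHook K Z →
         X (at d k a) → Y (at d k a) → Y (at d k b) → Z (at d k b) → X (at d k c) → Z (at d k c) →
         ∃[ e ] (X e × Y e × Z e)
median {d = d} {a = a} {b} {c} hX hY hZ xa ya yb zb xc zc
  with ℤ.≤-total a b | ℤ.≤-total b c | ℤ.≤-total a c
... | inj₁ ab | inj₁ bc | _ = _ , convex hX d xa xc ab bc , yb , zb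
... | inj₁ ab | inj₂ cb | inj₁ ac = _ , xc , convex hY d ya yb ac cb , zc
... | inj₁ ab | inj₂ cb | inj₂ ca = _ , xa , ya , convex hZ d zc zb ca ab
... | inj₂ ba | inj₁ bc | inj₁ ac = _ , xa , ya , convex hZ d zb zc ba ac
... | inj₂ ba | inj₁ bc | inj₂ ca = _ , xc , convex hY d yb ya bc ca , zc
... | inj₂ ba | inj₂ cb | _ = _ , convex hX d xc xa cb ba , yb , zb

-- X and Z bend at the same point, in the same way since they share an arm there.
two-and-one : ∀ {K X Y Z k l a b c} d → Clawfree K → IsHook K X → IsHook K Y → IsHook K Z →
              X (at d k a) → Y (at d k a) → Y (at d k b) → Z (at d k b) →
              X (at (flip d) l c) → Z (at (flip d) l c) → ∃[ e ] (X e × Y e × Z e)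
two-and-one {a = a} {b} d K! hX hY hZ xa ya yb zb xc zc
  with corner hX d xa xc | corner hZ d zb zc
... | s , ks , es , fs | t , kt , et , ft
  with unique-arm K! (flip d) ks kt
         (side-unique _ _ (beyond hX (flip d) _ fs xc) (beyond hZ (flip d) _ ft zc))
... | refl with ≼-total (arm s d) a b
... | inj₁ p = _ , xa , ya , between hZ d (arm s d) (inside∈ et) zb (beyond hX d _ es xa) p
... | inj₂ p = _ , between hX d (arm s d) (inside∈ es) xa (beyond hZ d _ et zb) p , yb , zb

rotate : ∀ {X Y Z : Pred GridEdge 0ℓ} → ∃[ e ] (X e × Y e × Z e) → ∃[ e ] (Z e × X e × Y e)
rotate (e , x , y , z) = e , z , x , y

-- Two of the three pairwise common edges have the same direction. If the third agrees, all lie on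
-- one line and `median` applies; otherwise `two-and-one` does, up to a rotation of the hooks.
triple-Helly : ∀ {K X Y Z} → Clawfree K → IsHook K X → IsHook K Y → IsHook K Z →
               Meets X Y → Meets Y Z → Meets Z X → ∃[ e ] (X e × Y e × Z e)
triple-Helly K! hX hY hZ (e , xe , ye) (f , yf , zf) (g , zg , xg) with as-at e
... | k , a , refl with direction e
... | d with edge-at d f | edge-at d g
triple-Helly K! hX hY hZ (e , xe , ye) (f , yf , zf) (g , zg , xg)
  | k , a , refl | d | inj₁ (l , b , refl) | inj₁ (m , c , refl)
  with line hY d ye yf | line hX d xe xg
... | refl | refl = median hX hY hZ xe ye yf zf xg zg
triple-Helly K! hX hY hZ (e , xe , ye) (f , yf , zf) (g , zg , xg)
  | k , a , refl | d | inj₁ (l , b , refl) | inj₂ (m , c , refl)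
  with line hY d ye yf
... | refl = two-and-one d K! hX hY hZ xe ye yf zf xg zg
triple-Helly K! hX hY hZ (e , xe , ye) (f , yf , zf) (g , zg , xg)
  | k , a , refl | d | inj₂ (l , b , refl) | inj₁ (m , c , refl)
  with line hX d xe xg
... | refl = rotate (rotate (two-and-one d K! hZ hX hY zg xg xe ye zf yf))
triple-Helly K! hX hY hZ (e , xe , ye) (f , yf , zf) (g , zg , xg)
  | k , a , refl | d | inj₂ (l , b , refl) | inj₂ (m , c , refl)
  with line hZ (flip d) zf zg
... | refl = rotate (two-and-one (flip d) K! hY hZ hX yf zf zg xg (reflip hY d ye) (reflip hX d xe))

module _ {K} (K! : Clawfree K) where

  -- `X` is the intersection accumulated so far: `∩-isHook` keeps it a hook, and `triple-Helly`
  -- keeps it meeting every remaining member.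
  Helly-at : ∀ {n X} (S : Fin n → Pred GridEdge 0ℓ) → (∀ u → IsHook K (S u)) → IsHook K X →
             (F : Subset n) → ∃ X → (∀ u → u ∈ F → Meets X (S u)) →
             (∀ u v → u ∈ F → v ∈ F → u ≢ v → Meets (S u) (S v)) →
             ∃[ e ] (X e × (∀ u → u ∈ F → S u e))
  Helly-at S hS hX [] (e , xe) _ _ = e , xe , λ ()
  Helly-at {X = X} S hS hX (outside ∷ F) x∃ xS SS
    with Helly-at (S ∘ suc) (hS ∘ suc) hX F x∃ (λ u → xS (suc u) ∘ there)
           (λ u v u∈ v∈ u≢v → SS (suc u) (suc v) (there u∈) (there v∈) (u≢v ∘ Fin.suc-injective))
  ... | e , xe , all = e , xe , λ { (suc u) (there u∈) → all u u∈ }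
  Helly-at {X = X} S hS hX (inside ∷ F) x∃ xS SS
    with Helly-at (S ∘ suc) (hS ∘ suc) (∩-isHook K! hX (hS zero)) F (xS zero here)
           (λ u u∈ → let e , x , s , t = triple-Helly K! hX (hS zero) (hS (suc u)) (xS zero here)
                                           (SS zero (suc u) here (there u∈) (λ ()))
                                           (meets-sym (xS (suc u) (there u∈)))
                     in e , (x , s) , t)
           (λ u v u∈ v∈ u≢v → SS (suc u) (suc v) (there u∈) (there v∈) (u≢v ∘ Fin.suc-injective))
  ... | e , (xe , se) , all = e , xe , λ { zero _ → se ; (suc u) (there u∈) → all u u∈ }

  Helly-family : ∀ {n} (S : Fin n → Pred GridEdge 0ℓ) → (∀ u → IsHook K (S u)) → (∀ u → ∃ (S u)) →
                 (F : Subset n) → (∀ u v → u ∈ F → v ∈ F → u ≢ v → Meets (S u) (S v)) →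
                 ∃[ e ] (∀ u → u ∈ F → S u e)
  -- The empty subfamily imposes nothing, so any edge serves.
  Helly-family S hS S∃ [] _ = at horizontal 0ℤ 0ℤ , λ ()
  Helly-family S hS S∃ (outside ∷ F) SS
    with Helly-family (S ∘ suc) (hS ∘ suc) (S∃ ∘ suc) F
           (λ u v u∈ v∈ u≢v → SS (suc u) (suc v) (there u∈) (there v∈) (u≢v ∘ Fin.suc-injective))
  ... | e , all = e , λ { (suc u) (there u∈) → all u u∈ }
  Helly-family S hS S∃ (inside ∷ F) SS
    with Helly-at (S ∘ suc) (hS ∘ suc) (hS zero) F (S∃ zero)
           (λ u u∈ → SS zero (suc u) here (there u∈) (λ ()))
           (λ u v u∈ v∈ u≢v → SS (suc u) (suc v) (there u∈) (there v∈) (u≢v ∘ Fin.suc-injective))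
  ... | e , se , all = e , λ { zero _ → se ; (suc u) (there u∈) → all u u∈ }

-- Links between two disjoint hooks

Apart : Pred GridEdge 0ℓ → Pred GridEdge 0ℓ → Set
Apart S T = ∀ e → S e → ¬ T e

-- C covers the gap between A and B on their common line, while D ∪ B has no gap.
gap : ∀ {K A B C D} d σ {k a b x} → IsHook K A → IsHook K B → IsHook K C → Apart A B → Apart C D →
      A (at d k a) → C (at d k a) → B (at d k b) → C (at d k b) → A (at d k x) → D (at d k x) →
      a ≼[ σ ] b → (∀ {c} → x ≼[ σ ] c → c ≼[ σ ] b → D (at d k c) ⊎ B (at d k c)) → ⊥
gap d σ {a = a} {b} {x} hA hB hC A∥B C∥D aa ca bb cb ax dx a≼b D∪B with ≼-total σ a x | ≼-total σ x b
... | inj₁ p | inj₁ q = C∥D _ (between hC d σ ca cb p q) dx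
... | inj₁ p | inj₂ q = A∥B _ (between hA d σ aa ax a≼b q) bb
... | inj₂ p | _ with D∪B p a≼b
... | inj₁ da = C∥D _ ca da
... | inj₂ ba = A∥B _ aa ba

-- Either D meets B on line k, or both bend at the same point of it.
union-convex : ∀ {K B D} d σ {k x b y} → IsHook K B → IsHook K D → B (at d k b) → D (at d k x) →
               D y → B y → ∀ {c} → x ≼[ σ ] c → c ≼[ σ ] b → D (at d k c) ⊎ B (at d k c)
union-convex d σ {x = x} {y = y} hB hD bb dx dy by {c} p q with edge-at d y
... | inj₁ (l , z , refl) with line hB d by bb
...   | refl with ≼-total σ c z
...     | inj₁ r = inj₁ (between hD d σ dx dy p r)
...     | inj₂ r = inj₂ (between hB d σ by bb r q)
union-convex d σ {x = x} {y = y} hB hD bb dx dy by {c} p q | inj₂ (l , z , refl)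
  with beyond⊎behind σ l c
... | inj₁ r = inj₂ (fill hB d σ bb by r q)
... | inj₂ r = inj₁ (fill hD d (opposite σ) dx dy (≼-opposite σ r) (≼-opposite σ p))

-- `C` bridges `A` and `B` on line `k`. If `D` met `A` there and also met `B`, then `D` and `B`
-- together would leave no gap for `C`. The two cases read the line from the edge in `A` towards the
-- edge in `B`.
one-straight-link : ∀ {K A B C D} d {k l a b x y} → IsHook K A → IsHook K B → IsHook K C → IsHook K D →
  Apart A B → Apart C D → A (at d k a) → C (at d k a) → B (at d l b) → C (at d l b) →
  A (at d k x) → D (at d k x) → D y → ¬ B y
one-straight-link d {a = a} {b} hA hB hC hD A∥B C∥D aa ca bb cb ax dx dy by with line hC d ca cb
... | refl with ≼-total upper a b
... | inj₁ p = gap d upper hA hB hC A∥B C∥D aa ca bb cb ax dx p (union-convex d upper hB hD bb dx dy by)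
... | inj₂ p = gap d lower hA hB hC A∥B C∥D aa ca bb cb ax dx p (union-convex d lower hB hD bb dx dy by)

record MeetsOn (d : Direction) (k : ℤ) (S T : Pred GridEdge 0ℓ) : Set where
  constructor on
  field
    {position} : ℤ
    left∈      : S (at d k position)
    right∈     : T (at d k position)

open MeetsOn

Link : Direction → Direction → (A B C : Pred GridEdge 0ℓ) → Set
Link d d′ A B C = ∃₂ λ k l → MeetsOn d k A C × MeetsOn d′ l B C

apart-sym : ∀ {S T} → Apart S T → Apart T S
apart-sym S∥T e t s = S∥T e s t

meets-on : ∀ d {S T} → Meets S T → (∃[ k ] MeetsOn d k S T) ⊎ (∃[ k ] MeetsOn (flip d) k S T)
meets-on d (e , s , t) with edge-at d e
... | inj₁ (k , a , refl) = inj₁ (k , on s t)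
... | inj₂ (k , a , refl) = inj₂ (k , on s t)

swap-link : ∀ {d d′ A B C} → Link d d′ A B C → Link d′ d B A C
swap-link (k , l , AC , BC) = l , k , BC , AC

blocked : ∀ {K A B C D} d {k} → IsHook K A → IsHook K B → IsHook K C → IsHook K D →
          Apart A B → Apart C D → Link d d A B C → MeetsOn d k A D → ¬ Meets B D
blocked d hA hB hC hD A∥B C∥D (k , l , on aa ca , on bb cb) (on ax dx) (y , by , dy)
  with line hA d aa ax
... | refl = one-straight-link d hA hB hC hD A∥B C∥D aa ca bb cb ax dx dy by

-- `blocked` excludes direction `d` for the meeting of `D` with `A`, and for that with `B` after
-- exchanging `A` and `B`.
evade : ∀ {K A B C D} d → IsHook K A → IsHook K B → IsHook K C → IsHook K D →
        Apart A B → Apart C D → Link d d A B C → Meets A D → Meets B D → Link (flip d) (flip d) A B D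
evade d hA hB hC hD A∥B C∥D C-link AD BD with meets-on d AD | meets-on d BD
... | inj₁ (_ , AD′) | _ = ⊥-elim (blocked d hA hB hC hD A∥B C∥D C-link AD′ BD)
... | _ | inj₁ (_ , BD′) = ⊥-elim (blocked d hB hA hC hD (apart-sym A∥B) C∥D (swap-link C-link) BD′ AD)
... | inj₂ (k , AD′) | inj₂ (l , BD′) = k , l , AD′ , BD′

-- If `C` met both `A` and `B` in direction `d`, then by `evade` both `D` and `E` would be straight
-- links in the other direction, where `D` blocks `E`.
crossing : ∀ {K A B C D E} → IsHook K A → IsHook K B → IsHook K C → IsHook K D → IsHook K E →
           Apart A B → Apart C D → Apart C E → Apart D E → Meets A C → Meets B C →
           Meets A D → Meets B D → Meets A E → Meets B E → ∃[ d ] Link d (flip d) A B C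
crossing hA hB hC hD hE A∥B C∥D C∥E D∥E (e , ae , ce) BC AD BD AE BE with as-at e
... | k , a , refl with direction e
... | d with meets-on d BC
... | inj₂ (l , BC′) = d , k , l , on ae ce , BC′
... | inj₁ (l , BC′) =
  ⊥-elim (blocked (flip d) hA hB hD hE A∥B D∥E D-link (proj₁ (proj₂ (proj₂ E-link))) BE)
  where
  C-link = k , l , on ae ce , BC′
  D-link = evade d hA hB hC hD A∥B C∥D C-link AD BD
  E-link = evade d hA hB hC hE A∥B C∥E C-link AE BE

Crosses : Direction → ℤ → ℤ → (A B C : Pred GridEdge 0ℓ) → Set
Crosses d k l A B C = MeetsOn d k A C × MeetsOn (flip d) l B C

-- `A` and `B` have one line per direction, so all links of the same kind use the same two lines and
-- bend where these cross.
aligned : ∀ {K A B C D} d {k l} → IsHook K A → IsHook K B →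
          Crosses d k l A B C → Link d (flip d) A B D → Crosses d k l A B D
aligned d hA hB (AC , BC) (k , l , AD , BD)
  with line hA d (left∈ AC) (left∈ AD) | line hB (flip d) (left∈ BC) (left∈ BD)
... | refl | refl = AD , BD

link-end : ∀ {K A B C} d {k l} → IsHook K C → Crosses d k l A B C → ∃[ σ ] EndsAt C d k σ l
link-end d hC (on _ c , on _ c′) = bend hC d c c′

apart-ends : ∀ {S T} d σ {k l} → Apart S T → EndsAt S d k σ l → ¬ EndsAt T d k σ l
apart-ends d σ S∥T (ending s _) (ending t _) = S∥T _ s t

-- All three bend at one point, where only two sides are available in direction `d`; two of them
-- would share the first edge of their arms.
no-three-crossings : ∀ {K A B C D E} d → IsHook K A → IsHook K B → IsHook K C → IsHook K D → IsHook K E →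
  Apart C D → Apart C E → Apart D E →
  Link d (flip d) A B C → Link d (flip d) A B D → ¬ Link d (flip d) A B E
no-three-crossings d hA hB hC hD hE C∥D C∥E D∥E (k , l , XC) LD LE
  with link-end d hC XC | link-end d hD (aligned d hA hB XC LD) | link-end d hE (aligned d hA hB XC LE)
... | σ , eC | τ , eD | ρ , eE with pigeonhole σ τ ρ
... | inj₁ refl        = apart-ends d σ C∥D eC eD
... | inj₂ (inj₁ refl) = apart-ends d σ C∥E eC eE
... | inj₂ (inj₂ refl) = apart-ends d τ D∥E eD eE

-- The shape ⌞ has only one arm per direction.
no-two-crossings : ∀ {A B C D} d → let ⌞-hook = IsHook (λ _ → ⌞ ≡_) in
  ⌞-hook A → ⌞-hook B → ⌞-hook C → ⌞-hook D → Apart C D →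
  Link d (flip d) A B C → ¬ Link d (flip d) A B D
no-two-crossings d hA hB hC hD C∥D (k , l , XC@(on _ c , on _ c′)) LD
  with aligned d hA hB XC LD
... | on _ e , on _ e′ with corner hC d c c′ | corner hD d e e′
... | _ , refl , eC , _ | _ , refl , eD , _ = apart-ends d upper C∥D eC eD

-- Rectangles of hooks

-- Being disjoint, `C` and `P` leave `l` towards opposite sides. `A` meets both of these arms, so by
-- convexity it contains both edges at `l`.
through : ∀ {K A C P} d σ τ {k l} → IsHook K A → IsHook K C → IsHook K P → Apart C P →
          MeetsOn d k A C → MeetsOn d k A P → EndsAt C d k σ l → EndsAt P d k τ l →
          ∀ ρ → A (at d k (near ρ l))
through d σ τ {k} {l} hA hC hP C∥P (on aa ca) (on ab pb) eC eP ρ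
  with ≢⇒opposite {σ} {τ} (λ { refl → apart-ends d σ C∥P eC eP })
... | refl with same⊎opposite σ ρ
...   | inj₁ refl = between hA d σ ab aa (≼-trans σ b≼ (near-opposite≼near σ l)) ≼a
  where
  ≼a = beyond hC d σ eC ca
  b≼ = ≼-opposite⁻¹ σ (beyond hP d (opposite σ) eP pb)
...   | inj₂ refl = between hA d σ ab aa b≼ (≼-trans σ (near-opposite≼near σ l) ≼a)
  where
  ≼a = beyond hC d σ eC ca
  b≼ = ≼-opposite⁻¹ σ (beyond hP d (opposite σ) eP pb)

-- For hooks and perpendicular `d` and `d′`, `C` and `P` bend at the same crossing and, being
-- disjoint, with opposite arms in both directions.
Opposed : Direction → Direction → ℤ → ℤ → (A B C P : Pred GridEdge 0ℓ) → Set
Opposed d d′ k l A B C P =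
  (MeetsOn d k A C × MeetsOn d′ l B C) × (MeetsOn d k A P × MeetsOn d′ l B P) × Apart C P

opposed-through : ∀ {K A B C P} d {k l} → IsHook K A → IsHook K C → IsHook K P →
                  Opposed d (flip d) k l A B C P → ∀ ρ → A (at d k (near ρ l))
opposed-through d hA hC hP ((AC@(on _ c) , on _ c′) , (AP@(on _ p) , on _ p′) , C∥P)
  with bend hC d c c′ | bend hP d p p′
... | σ , eC | τ , eP = through d σ τ hA hC hP C∥P AC AP eC eP

-- The perpendicular case of `opposed-through`, stated separately so that no `flip (flip d)` arises.
opposed-through⊥ : ∀ {K A B C P} d {k l} → IsHook K A → IsHook K C → IsHook K P →
                   Opposed (flip d) d k l A B C P → ∀ ρ → A (at (flip d) k (near ρ l))
opposed-through⊥ d hA hC hP ((AC@(on _ c) , on _ c′) , (AP@(on _ p) , on _ p′) , C∥P)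
  with bend⊥ hC d c′ c | bend⊥ hP d p′ p
... | σ , eC | τ , eP = through (flip d) σ τ hA hC hP C∥P AC AP eC eP

no-bend-inside : ∀ {S d k σ l} → EndsAt S d k σ l → ¬ (∀ ρ → S (at d k (near ρ l)))
no-bend-inside {σ = σ} (ending _ ns) all = ns (all (opposite σ))

-- D meets A, C and C′, so it bends where A does and runs along A up to C.  Were C to
-- leave its bend away from that of A, then D would have to pass the partner P of C.
inward : ∀ {K A B C P C′ P′ D} d ρ σ {k l m n} →
  IsHook K A → IsHook K C → IsHook K P → IsHook K C′ → IsHook K P′ → IsHook K D →
  Opposed d (flip d) k l A B C P → Opposed (flip d) d m n A B C′ P′ →
  Meets D A → Meets D C → Meets D C′ → Apart D P →
  EndsAt A d k ρ m → EndsAt C d k σ l → σ ≡ opposite ρ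
inward {A = A} {C = C} {P} {C′} {P′} {D} d ρ σ {k} {l} {m} {n} hA hC hP hC′ hP′ hD
  o@((on _ c , on _ c⊥) , (on _ p , on _ p⊥) , C∥P)
  o′@((on a⊥ c′⊥ , on _ c′) , _) DA DC DC′ D∥P eA eC = ≢⇒opposite (absurd ∘ sym)
  where
  A-through : ∀ τ → A (at d k (near τ l))
  A-through = opposed-through d hA hC hP o
  -- The rectangle is not degenerate: `A` passes straight through the coordinates `l` and `n` on its
  -- two lines, but stops at its own bend, which lies at `m` and `k`.
  l≢m : l ≢ m
  l≢m refl = no-bend-inside eA A-through
  k≢n : k ≢ n
  k≢n refl = let τ , e = bend⊥ hA d (inside∈ eA) a⊥
             in no-bend-inside e (opposed-through⊥ d hA hC′ hP′ o′)

  DC-on : MeetsOn d k D C ⊎ MeetsOn (flip d) l D C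
  DC-on with meets-on d DC
  ... | inj₁ (_ , on dx cx) with line hC d c cx
  ...   | refl = inj₁ (on dx cx)
  DC-on | inj₂ (_ , on dx cx) with line hC (flip d) c⊥ cx
  ...   | refl = inj₂ (on dx cx)

  DC′-on : MeetsOn d n D C′ ⊎ MeetsOn (flip d) m D C′
  DC′-on with meets-on d DC′
  ... | inj₁ (_ , on dx cx) with line hC′ d c′ cx
  ...   | refl = inj₁ (on dx cx)
  DC′-on | inj₂ (_ , on dx cx) with line hC′ (flip d) c′⊥ cx
  ...   | refl = inj₂ (on dx cx)

  -- `D` has one line per direction, so it cannot use both `k` and `n`, nor both `l` and `m`. With
  -- `l` and `n` it would be on the lines of `B` and could not meet `A`.
  D-bend : MeetsOn d k D C × MeetsOn (flip d) m D C′
  D-bend with DC-on | DC′-on | meets-on d DA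
  ... | inj₁ DC₁ | inj₂ DC′₂ | _ = DC₁ , DC′₂
  ... | inj₁ (on dx _) | inj₁ (on dy _) | _ = contradiction (line hD d dx dy) k≢n
  ... | inj₂ (on dx _) | inj₂ (on dy _) | _ = contradiction (line hD (flip d) dx dy) l≢m
  ... | inj₂ (on dx _) | inj₁ (on dy _) | inj₁ (_ , on dz az) =
    contradiction (trans (line hA d (inside∈ eA) az) (line hD d dz dy)) k≢n
  ... | inj₂ (on dx _) | inj₁ (on dy _) | inj₂ (_ , on dz az) =
    contradiction (trans (line hD (flip d) dx dz) (line hA (flip d) az a⊥)) l≢m

  -- `D` runs from its bend at `m` past `l`, so it contains the edge just before `l`, which is the
  -- first edge of the arm of `P`.
  absurd : σ ≡ ρ → ⊥
  absurd refl =
    let on dx cx , on dy _ = D-bend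
        τ , eP = bend hP d p p⊥
        τ≡ = ≢⇒opposite {σ} {τ} λ { refl → apart-ends d σ C∥P eC eP }
    in D∥P _ (fill hD d σ dx dy (beyond hA d σ eA (A-through (opposite σ)))
                (≼-trans σ (near-opposite≼near σ l) (beyond hC d σ eC cx)))
             (subst (λ υ → P (at d k (near υ l))) τ≡ (inside∈ eP))

-- `A` runs from its end at `m` across `l`, and `B` from its end at `l` across `m`. If both ran the
-- same way, each of `l` and `m` would lie beyond the other.
facing : ∀ {K A B} d ρ ρ′ {k l m n} → IsHook K A → IsHook K B → EndsAt A d k ρ m → EndsAt B d n ρ′ l →
         (∀ τ → A (at d k (near τ l))) → (∀ τ → B (at d n (near τ m))) → ρ′ ≡ opposite ρ
facing d ρ ρ′ {l = l} {m} hA hB eA eB A-through B-through = ≢⇒opposite λ { refl →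
  not-both ρ {m} (beyond hA d ρ eA (A-through (opposite ρ)))
    (≼-trans ρ (near-opposite≼near ρ l) (beyond hB d ρ eB (B-through (opposite ρ)))) }

swap-opposed : ∀ {d d′ k l A B C P} → Opposed d d′ k l A B C P → Opposed d′ d l k B A C P
swap-opposed ((AC , BC) , (AP , BP) , C∥P) = (BC , AC) , (BP , AP) , C∥P

-- The bends of A, C, B and C′ are the corners of a rectangle and their arms lie along its sides.
no-frame : ∀ {A B C P C′ P′ D E} {k l m n} → let ⌟-free = IsHook (λ _ s → s ≢ ⌟) in
  ⌟-free A → ⌟-free B → ⌟-free C → ⌟-free P → ⌟-free C′ → ⌟-free P′ → ⌟-free D → ⌟-free E →
  Opposed horizontal vertical k l A B C P → Opposed vertical horizontal m n A B C′ P′ →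
  Meets D A → Meets D C → Meets D C′ → Apart D P → Apart D P′ →
  Meets E B → Meets E C → Meets E C′ → Apart E P → ¬ Apart E P′
no-frame {A} {B} hA hB hC hP hC′ hP′ hD hE o o′ DA DC DC′ D∥P D∥P′ EB EC EC′ E∥P E∥P′
  with o | o′
... | (on a c , on b c⊥) , _ | (on a⊥ c′⊥ , on b⊥ c′) , _
  with corner hA horizontal a a⊥ | corner hB horizontal b⊥ b
     | corner hC horizontal c c⊥ | corner hC′ horizontal c′ c′⊥
... | sA , A≢⌟ , Aₕ , Aᵥ | sB , B≢⌟ , Bₕ , Bᵥ | sC , C≢⌟ , Cₕ , Cᵥ | sC′ , C′≢⌟ , C′ₕ , C′ᵥ =
  shapes sA sB sC sC′ A≢⌟ B≢⌟ C≢⌟ C′≢⌟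
    (facing horizontal _ _ hA hB Aₕ Bₕ (opposed-through horizontal hA hC hP o)
      (opposed-through horizontal hB hC′ hP′ (swap-opposed o′)))
    (facing vertical _ _ hA hB Aᵥ Bᵥ (opposed-through vertical hA hC′ hP′ o′)
      (opposed-through vertical hB hC hP (swap-opposed o)))
    (inward horizontal _ _ hA hC hP hC′ hP′ hD o o′ DA DC DC′ D∥P Aₕ Cₕ)
    (inward vertical _ _ hB hC hP hC′ hP′ hE (swap-opposed o) (swap-opposed o′) EB EC EC′ E∥P Bᵥ Cᵥ)
    (inward horizontal _ _ hB hC′ hP′ hC hP hE (swap-opposed o′) (swap-opposed o) EB EC′ EC E∥P′ Bₕ C′ₕ)
    (inward vertical _ _ hA hC′ hP′ hC hP hD o′ o DA DC′ DC D∥P′ Aᵥ C′ᵥ)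
  where
  -- The shape of `A` determines the corner that is `⌟`: `A` itself, or for `⌜`, `⌞`, `⌝` the hook
  -- `B`, `C`, `C′` respectively.
  shapes : ∀ sA sB sC sC′ → sA ≢ ⌟ → sB ≢ ⌟ → sC ≢ ⌟ → sC′ ≢ ⌟ →
    arm sB horizontal ≡ opposite (arm sA horizontal) → arm sB vertical ≡ opposite (arm sA vertical) →
    arm sC horizontal ≡ opposite (arm sA horizontal) → arm sC vertical ≡ opposite (arm sB vertical) →
    arm sC′ horizontal ≡ opposite (arm sB horizontal) → arm sC′ vertical ≡ opposite (arm sA vertical) → ⊥
  shapes ⌟ _ _ _ A≢⌟ _ _ _ _ _ _ _ _ _ = A≢⌟ refl
  shapes ⌜ sB _ _ _ B≢⌟ _ _ Bₕ Bᵥ _ _ _ _ = B≢⌟ (is-⌟ sB Bₕ Bᵥ)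
  shapes ⌞ sB sC _ _ _ C≢⌟ _ _ Bᵥ Cₕ Cᵥ _ _ = C≢⌟ (is-⌟ sC Cₕ (trans Cᵥ (cong opposite Bᵥ)))
  shapes ⌝ sB _ sC′ _ _ _ C′≢⌟ Bₕ _ _ _ C′ₕ C′ᵥ = C′≢⌟ (is-⌟ sC′ (trans C′ₕ (cong opposite Bₕ)) C′ᵥ)

-- Straight runs of a path

next : Side → ℤ → ℤ
next lower = ℤ.pred
next upper = ℤ.suc

-- The coordinate of the end at which a run in direction σ enters the edge numbered a.
entry : Side → ℤ → ℤ
entry lower = ℤ.suc
entry upper = λ a → a

entry-near : ∀ σ c → entry σ (near σ c) ≡ c
entry-near lower c = ℤ.suc-pred c
entry-near upper c = refl

walk : Side → ℤ → ℕ → ℤ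
walk σ a zero    = a
walk σ a (suc k) = walk σ (next σ a) k

≼-next : ∀ σ a → a ≼[ σ ] next σ a
≼-next lower a = ℤ.<⇒≤ (ℤ.i≤pred[j]⇒i<j ℤ.≤-refl)
≼-next upper a = ℤ.i≤suc[i] a

next-≼ : ∀ σ {a b} → a ≼[ σ ] b → a ≢ b → next σ a ≼[ σ ] b
next-≼ lower p a≢b = ℤ.i<j⇒i≤pred[j] (ℤ.≤∧≢⇒< p (a≢b ∘ sym))
next-≼ upper p a≢b = ℤ.i<j⇒suc[i]≤j (ℤ.≤∧≢⇒< p a≢b)

≼-walk : ∀ σ a k → a ≼[ σ ] walk σ a k
≼-walk σ a zero    = ≼-refl σ
≼-walk σ a (suc k) = ≼-trans σ (≼-next σ a) (≼-walk σ (next σ a) k)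

walk-dense : ∀ σ {a b} k → a ≼[ σ ] b → b ≼[ σ ] walk σ a k → ∃[ j ] (j ℕ.≤ k × b ≡ walk σ a j)
walk-dense σ zero p q = zero , z≤n , ≼-antisym σ q p
walk-dense σ {a} {b} (suc k) p q with a ℤ.≟ b
... | yes refl = zero , z≤n , refl
... | no a≢b with walk-dense σ k (next-≼ σ p a≢b) q
... | j , j≤k , eq = suc j , s≤s j≤k , eq

-- `target` reduces only for a known direction; the case split is made here once and for all.
ends-of : ∀ d {l a q} → q endpointOf at d l a → q ≡ point d l a ⊎ q ≡ point d l (ℤ.suc a)
ends-of horizontal e = e
ends-of vertical   e = e

of-ends : ∀ d {l a q} → q ≡ point d l a ⊎ q ≡ point d l (ℤ.suc a) → q endpointOf at d l a
of-ends horizontal e = e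
of-ends vertical   e = e

entry-endpoint : ∀ d σ {l a} → point d l (entry σ a) endpointOf at d l a
entry-endpoint d lower = of-ends d (inj₂ refl)
entry-endpoint d upper = of-ends d (inj₁ refl)

next-entry-endpoint : ∀ d σ {l a} → point d l (entry σ (next σ a)) endpointOf at d l a
next-entry-endpoint d lower {l} {a} = of-ends d (inj₁ (cong (point d l) (ℤ.suc-pred a)))
next-entry-endpoint d upper = of-ends d (inj₂ refl)

near-entry : ∀ σ a → near σ (entry σ a) ≡ a
near-entry lower a = ℤ.pred-suc a
near-entry upper a = refl

leaving-horizontal : ∀ p s → leaving p (horizontalArm s) ≡ spoke p horizontal (arm s horizontal)
leaving-horizontal p ⌞ = refl
leaving-horizontal p ⌟ = refl
leaving-horizontal p ⌜ = refl
leaving-horizontal p ⌝ = refl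

leaving-vertical : ∀ p s → leaving p (verticalArm s) ≡ spoke p vertical (arm s vertical)
leaving-vertical p ⌞ = refl
leaving-vertical p ⌟ = refl
leaving-vertical p ⌜ = refl
leaving-vertical p ⌝ = refl

endpoint-spoke : ∀ {p e} → p endpointOf e → ∃₂ λ d σ → e ≡ spoke p d σ
endpoint-spoke {e = edge (x , y) horizontal} (inj₁ refl) = horizontal , upper , refl
endpoint-spoke {e = edge (x , y) horizontal} (inj₂ refl) =
  horizontal , lower , cong (λ a → edge (a , y) horizontal) (sym (ℤ.pred-suc x))
endpoint-spoke {e = edge (x , y) vertical} (inj₁ refl) = vertical , upper , refl
endpoint-spoke {e = edge (x , y) vertical} (inj₂ refl) =
  vertical , lower , cong (λ b → edge (x , b) vertical) (sym (ℤ.pred-suc y))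

shape : ∀ σ τ → ∃[ s ] (σ ≡ arm s horizontal × τ ≡ arm s vertical)
shape lower lower = ⌝ , refl , refl
shape lower upper = ⌟ , refl , refl
shape upper lower = ⌜ , refl , refl
shape upper upper = ⌞ , refl , refl

-- An edge of the same direction touching `at d l a` is that edge or one of its two neighbours on
-- the line. The edge itself and the neighbour behind it contain the entry point.
step : ∀ d σ {l a q f} → direction f ≡ d → q endpointOf at d l a → q endpointOf f →
       ¬ point d l (entry σ a) endpointOf f → f ≡ at d l (next σ a)
step d σ {l} {a} {q} {f} refl qe qf out with as-at f
... | l′ , a′ , refl with ends-of d qe | ends-of d qf
... | inj₁ refl | inj₁ eq with point-injective d eq
...   | refl , refl = contradiction (entry-endpoint d σ) out
step d lower {l} refl qe qf out | l′ , a′ , refl | inj₁ refl | inj₂ eq with point-injective d eq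
...   | refl , refl = cong (at d l) (sym (ℤ.pred-suc a′))
step d upper refl qe qf out | l′ , a′ , refl | inj₁ refl | inj₂ eq = contradiction (of-ends d (inj₂ eq)) out
step d lower refl qe qf out | l′ , a′ , refl | inj₂ refl | inj₁ eq = contradiction (of-ends d (inj₁ eq)) out
step d upper refl qe qf out | l′ , a′ , refl | inj₂ refl | inj₁ eq with point-injective d eq
...   | refl , refl = refl
step d σ {a = a} refl qe qf out | l′ , a′ , refl | inj₂ refl | inj₂ eq with point-injective d eq
...   | refl , eq′ with trans (sym (ℤ.pred-suc a)) (trans (cong ℤ.pred eq′) (ℤ.pred-suc a′))
...   | refl = contradiction (entry-endpoint d σ) out

-- `out` fixes the sense of travel at the first step. Afterwards turning back is impossible, because
-- edges two places apart share no point.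
run : ∀ (f : ℕ → GridEdge) N d σ {l a} →
      (∀ k → k ℕ.< N → direction (f (suc k)) ≡ direction (f k)) →
      (∀ k → k ℕ.< N → ∃[ q ] q commonTo f k and f (suc k)) →
      (∀ k → suc k ℕ.< N → ShareNoPoint (f k) (f (suc (suc k)))) →
      f 0 ≡ at d l a → (0 ℕ.< N → ¬ point d l (entry σ a) endpointOf f 1) →
      ∀ k → k ℕ.≤ N → f k ≡ at d l (walk σ a k)
run f N d σ same-dir touch skip f0 out zero _ = f0
run f (suc N) d σ {l} {a} same-dir touch skip f0 out (suc k) (s≤s k≤N) =
  run (f ∘ suc) N d σ (λ j → same-dir (suc j) ∘ s≤s) (λ j → touch (suc j) ∘ s≤s)
    (λ j → skip (suc j) ∘ s≤s) f1
    (λ 0<N on₂ → skip 0 (s≤s 0<N) _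
      (subst (_ endpointOf_) (sym f0) (next-entry-endpoint d σ) , on₂)) k k≤N
  where
  0<1+N = ℕ.s≤s z≤n
  f1 : f 1 ≡ at d l (next σ a)
  f1 with touch 0 0<1+N
  ... | q , q₀ , q₁ = step d σ (trans (same-dir 0 0<1+N) (cong direction f0))
                        (subst (q endpointOf_) f0 q₀) q₁ (out 0<1+N)

-- The edges of direction `d` form an initial segment, possibly empty, of the half-line from `c`
-- towards `σ`.
record Arm (S : Pred GridEdge 0ℓ) (d : Direction) (l : ℤ) (σ : Side) (c : ℤ) : Set where
  field
    located : ∀ {k b} → S (at d k b) → k ≡ l × near σ c ≼[ σ ] b
    filled  : ∀ {b b′} → S (at d l b) → near σ c ≼[ σ ] b′ → b′ ≼[ σ ] b → S (at d l b′)

filled≤ : ∀ {S d l} σ {c} → Arm S d l σ c → ∀ {k a b c′} →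
          S (at d k a) → S (at d k c′) → a ℤ.≤ b → b ℤ.≤ c′ → S (at d k b)
filled≤ lower arm sa sc p q with Arm.located arm sa | Arm.located arm sc
... | refl , _ | _ , c≽ = Arm.filled arm sa (ℤ.≤-trans q c≽) p
filled≤ upper arm sa sc p q with Arm.located arm sa | Arm.located arm sc
... | refl , ≼a | _ = Arm.filled arm sc (ℤ.≤-trans ≼a p) q

by-direction : ∀ {Q : Direction → Set} d → Q d → Q (flip d) → ∀ d′ → Q d′
by-direction horizontal q _ horizontal = q
by-direction horizontal _ q vertical   = q
by-direction vertical   _ q horizontal = q
by-direction vertical   q _ vertical   = q

run⇒Arm : ∀ {S d l σ c} N → (∀ k → k ℕ.≤ N → S (at d l (walk σ (near σ c) k))) →
          (∀ {k b} → S (at d k b) → ∃[ j ] (j ℕ.≤ N × at d k b ≡ at d l (walk σ (near σ c) j))) →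
          Arm S d l σ c
run⇒Arm {S} {d} {l} {σ} {c} N covers covered = record { located = located ; filled = filled }
  where
  located : ∀ {k b} → S (at d k b) → k ≡ l × near σ c ≼[ σ ] b
  located s with covered s
  ... | j , _ , eq with at-injective {d} eq
  ... | _ , refl , refl = refl , ≼-walk σ (near σ c) j
  filled : ∀ {b b′} → S (at d l b) → near σ c ≼[ σ ] b′ → b′ ≼[ σ ] b → S (at d l b′)
  filled s p q with covered s
  ... | j , j≤N , eq with at-injective {d} eq
  ... | _ , _ , refl with walk-dense σ j p q
  ... | i , i≤j , refl = covers i (ℕ.≤-trans i≤j j≤N)

-- Any edge of direction `d` forces the first edge of its arm at `p` by `filled`, while `located`
-- excludes the edge on the other side of `p`.
arms⇒hook : ∀ {K S} p s → (∀ d → Arm S d (across d p) (arm s d) (along d p)) →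
            (∀ {k l a b} → S (at horizontal k a) → S (at vertical l b) → K p s) → IsHook K S
arms⇒hook {K} {S} p s arms bent = record
  { line   = λ d sa sb → trans (proj₁ (Arm.located (arms d) sa)) (sym (proj₁ (Arm.located (arms d) sb)))
  ; convex = λ d → filled≤ (arm s d) (arms d)
  ; corner = corner′
  }
  where
  end : ∀ d {k a} → S (at d k a) → EndsAt S d k (arm s d) (along d p)
  end d sa with Arm.located (arms d) sa
  ... | refl , ≼a = ending (Arm.filled (arms d) sa (≼-refl (arm s d)) ≼a)
                      λ so → not-both (arm s d) (proj₂ (Arm.located (arms d) so)) (≼-refl (arm s d))
  corner′ : ∀ d {k l a b} → S (at d k a) → S (at (flip d) l b) →
            ∃[ s ] (K (point d k l) s × EndsAt S d k (arm s d) l × EndsAt S (flip d) l (arm s (flip d)) k)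
  corner′ horizontal sa sb with Arm.located (arms horizontal) sa | Arm.located (arms vertical) sb
  ... | refl , _ | refl , _ = s , bent sa sb , end horizontal sa , end vertical sb
  corner′ vertical sa sb with Arm.located (arms horizontal) sb | Arm.located (arms vertical) sa
  ... | refl , _ | refl , _ = s , bent sb sa , end vertical sa , end horizontal sb

-- Paths as hooks

-- Natural-number positions make it easy to shift and reverse a path; positions past the end default
-- to the last index.
nth : ∀ n → ℕ → Fin (suc n)
nth n       zero    = zero
nth zero    (suc _) = zero
nth (suc n) (suc m) = suc (nth n m)

toℕ-nth : ∀ {n m} → m ℕ.≤ n → toℕ (nth n m) ≡ m
toℕ-nth z≤n     = refl
toℕ-nth (s≤s p) = cong suc (toℕ-nth p)

nth-toℕ : ∀ {n} (j : Fin (suc n)) → nth n (toℕ j) ≡ j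
nth-toℕ {n} j = Fin.toℕ-injective (toℕ-nth (Fin.toℕ≤pred[n] j))

_≟ᵈ_ : (d d′ : Direction) → Dec (d ≡ d′)
horizontal ≟ᵈ horizontal = yes refl
horizontal ≟ᵈ vertical   = no λ ()
vertical   ≟ᵈ horizontal = no λ ()
vertical   ≟ᵈ vertical   = yes refl

point-along-across : ∀ d p → point d (across d p) (along d p) ≡ p
point-along-across horizontal p = refl
point-along-across vertical   p = refl

entry-spoke : ∀ d σ p → point d (across d p) (entry σ (near σ (along d p))) ≡ p
entry-spoke d σ p = trans (cong (point d (across d p)) (entry-near σ (along d p))) (point-along-across d p)

spoke-endpoint : ∀ p d σ → p endpointOf spoke p d σ
spoke-endpoint p d σ = subst (_endpointOf spoke p d σ) (entry-spoke d σ p) (entry-endpoint d σ)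

module _ (P : Path) where
  open Path P

  nthEdge : ℕ → GridEdge
  nthEdge m = edgeAt (nth joints m)

  nthEdge-toℕ : ∀ j → nthEdge (toℕ j) ≡ edgeAt j
  nthEdge-toℕ j = cong edgeAt (nth-toℕ j)

  before-nth : ∀ i → before i ≡ nthEdge (toℕ i)
  before-nth i = trans (sym (nthEdge-toℕ (inject₁ i))) (cong nthEdge (Fin.toℕ-inject₁ i))

  after-nth : ∀ i → after i ≡ nthEdge (suc (toℕ i))
  after-nth i = sym (nthEdge-toℕ (suc i))

  joint : ∀ {k} → k ℕ.< joints → ∃[ i ] (toℕ i ≡ k)
  joint k<n = fromℕ< k<n , Fin.toℕ-fromℕ< k<n

  nth-touch : ∀ k → k ℕ.< joints → ShareExactlyOnePoint (nthEdge k) (nthEdge (suc k))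
  nth-touch k k<n with joint k<n
  ... | i , refl = subst₂ ShareExactlyOnePoint (before-nth i) (after-nth i) (consecutive i)

  nth-skip : ∀ i j → j ℕ.≤ joints → suc i ℕ.< j → ShareNoPoint (nthEdge i) (nthEdge j)
  nth-skip i j j≤n i<j = nonconsecutive (nth joints i) (nth joints j)
    (subst₂ (λ x y → suc x ℕ.< y)
      (sym (toℕ-nth (ℕ.≤-trans (ℕ.<⇒≤ (ℕ.<-trans (ℕ.n<1+n i) i<j)) j≤n))) (sym (toℕ-nth j≤n)) i<j)

  nth-direction : ∀ k → k ℕ.< joints → (∀ i → toℕ i ≡ k → ¬ IsBend i) →
                  direction (nthEdge (suc k)) ≡ direction (nthEdge k)
  nth-direction k k<n no-bend with joint k<n
  ... | i , refl with direction (before i) ≟ᵈ direction (after i)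
  ... | no bend = contradiction bend (no-bend i refl)
  ... | yes eq = trans (cong direction (sym (after-nth i))) (trans (sym eq) (cong direction (before-nth i)))

  ∈ₚ-nth : ∀ k → nthEdge k ∈ₚ P
  ∈ₚ-nth k = nth joints k , refl

  nth-∈ₚ : ∀ {e} → e ∈ₚ P → ∃[ m ] (m ℕ.≤ joints × e ≡ nthEdge m)
  nth-∈ₚ (j , refl) = toℕ j , Fin.toℕ≤pred[n] j , sym (nthEdge-toℕ j)

  module _ (one-bend : AtMostOneBend) (i : Fin joints) (bend : IsBend i) where

    straight-elsewhere : ∀ k → k ≢ toℕ i → ∀ j → toℕ j ≡ k → ¬ IsBend j
    straight-elsewhere k k≢i j refl bend′ = k≢i (cong toℕ (one-bend j i bend′ bend))

    -- The run leads away from `p`, since `p` lies on the edge before the bend, which shares no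
    -- point with the second edge after it.
    after-run : ∀ p d σ → p endpointOf nthEdge (toℕ i) → after i ≡ spoke p d σ →
                ∀ k → k ℕ.≤ joints ∸ suc (toℕ i) →
                nthEdge (k ℕ.+ suc (toℕ i)) ≡ at d (across d p) (walk σ (near σ (along d p)) k)
    after-run p d σ p∈ eq = run f N d σ
      (λ k k<N → nth-direction _ (in-range k k<N) (straight-elsewhere _ (ℕ.m+1+n≢n k)))
      (λ k k<N → let q , c , _ = nth-touch _ (in-range k k<N) in q , c)
      (λ k k<N → nth-skip _ _ (in-range (suc k) k<N) (ℕ.n<1+n _))
      (trans (sym (after-nth i)) eq)
      (λ 0<N on₁ → nth-skip (toℕ i) _ (in-range 0 0<N) (ℕ.n<1+n _) p
        (p∈ , subst (_endpointOf nthEdge (suc (suc (toℕ i)))) (entry-spoke d σ p) on₁))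
      where
      f : ℕ → GridEdge
      f k = nthEdge (k ℕ.+ suc (toℕ i))
      N = joints ∸ suc (toℕ i)
      in-range : ∀ k → k ℕ.< N → k ℕ.+ suc (toℕ i) ℕ.< joints
      in-range k k<N = subst (suc k ℕ.+ suc (toℕ i) ℕ.≤_)
        (ℕ.m∸n+n≡m (Fin.toℕ<n i)) (ℕ.+-monoˡ-≤ (suc (toℕ i)) k<N)

    -- The argument of `after-run` on the reversed initial part; `descend` shows that the
    -- subtraction does not truncate in the range used.
    before-run : ∀ p d σ → p endpointOf nthEdge (suc (toℕ i)) → before i ≡ spoke p d σ →
                 ∀ k → k ℕ.≤ toℕ i →
                 nthEdge (toℕ i ∸ k) ≡ at d (across d p) (walk σ (near σ (along d p)) k)
    before-run p d σ p∈ eq = run f (toℕ i) d σ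
      (λ k k<N → sym (subst (λ m → direction (nthEdge m) ≡ direction (f (suc k))) (descend k<N)
                   (nth-direction _ (in-range k<N) (straight-elsewhere _ (ℕ.<⇒≢ (below k<N))))))
      (λ k k<N → let q , (c , c′) , _ = nth-touch _ (in-range k<N)
                 in q , subst (λ m → q endpointOf nthEdge m) (descend k<N) c′ , c)
      (λ k k<N q (c , c′) → nth-skip (toℕ i ∸ suc (suc k)) (toℕ i ∸ k)
         (ℕ.≤-trans (ℕ.m∸n≤m (toℕ i) k) (ℕ.<⇒≤ (Fin.toℕ<n i)))
         (ℕ.≤-reflexive (trans (cong suc (descend k<N)) (descend (ℕ.<⇒≤ k<N)))) q (c′ , c))
      (trans (sym (before-nth i)) eq)
      (λ 0<N on₁ → nth-skip (toℕ i ∸ 1) (suc (toℕ i)) (Fin.toℕ<n i)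
        (s≤s (ℕ.≤-reflexive (descend 0<N))) p
        (subst (_endpointOf nthEdge (toℕ i ∸ 1)) (entry-spoke d σ p) on₁ , p∈))
      where
      f : ℕ → GridEdge
      f k = nthEdge (toℕ i ∸ k)
      descend : ∀ {k} → k ℕ.< toℕ i → suc (toℕ i ∸ suc k) ≡ toℕ i ∸ k
      descend k<i = sym (ℕ.+-∸-assoc 1 k<i)
      below : ∀ {k} → k ℕ.< toℕ i → toℕ i ∸ suc k ℕ.< toℕ i
      below {k} k<i = subst (ℕ._≤ toℕ i) (sym (descend k<i)) (ℕ.m∸n≤m (toℕ i) k)
      in-range : ∀ {k} → k ℕ.< toℕ i → toℕ i ∸ suc k ℕ.< joints
      in-range k<i = ℕ.<-trans (below k<i) (Fin.toℕ<n i)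

    bent-cases : ∀ p d σ τ → before i ≡ spoke p d σ → after i ≡ spoke p (flip d) τ →
                 ∀ {e} → e ∈ₚ P →
                 (∃[ k ] (k ℕ.≤ toℕ i × e ≡ at d (across d p) (walk σ (near σ (along d p)) k))) ⊎
                 (∃[ k ] (k ℕ.≤ joints ∸ suc (toℕ i) ×
                          e ≡ at (flip d) (across (flip d) p) (walk τ (near τ (along (flip d) p)) k)))
    bent-cases p d σ τ eqb eqa e∈ with nth-∈ₚ e∈
    ... | m , m≤n , refl with m ℕ.≤? toℕ i
    ... | yes m≤i = inj₁ (toℕ i ∸ m , ℕ.m∸n≤m (toℕ i) m ,
      trans (cong nthEdge (sym (ℕ.m∸[m∸n]≡n m≤i)))
        (before-run p d σ (subst (p endpointOf_) (trans (sym eqa) (after-nth i)) (spoke-endpoint p (flip d) τ))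
          eqb (toℕ i ∸ m) (ℕ.m∸n≤m (toℕ i) m)))
    ... | no m≰i = inj₂ (m ∸ suc (toℕ i) , m-bound ,
      trans (cong nthEdge (sym (ℕ.m∸n+n≡m (ℕ.≰⇒> m≰i))))
        (after-run p (flip d) τ (subst (p endpointOf_) (trans (sym eqb) (before-nth i)) (spoke-endpoint p d σ))
          eqa (m ∸ suc (toℕ i)) m-bound))
      where
      m-bound : m ∸ suc (toℕ i) ℕ.≤ joints ∸ suc (toℕ i)
      m-bound = ℕ.∸-monoˡ-≤ (suc (toℕ i)) m≤n

    bent-arms : ∀ p s d →
                before i ≡ spoke p d (arm s d) → after i ≡ spoke p (flip d) (arm s (flip d)) →
                ∀ d′ → Arm (_∈ₚ P) d′ (across d′ p) (arm s d′) (along d′ p)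
    bent-arms p s d eqb eqa = by-direction d
      (run⇒Arm (toℕ i)
        (λ k k≤i → subst (_∈ₚ P)
          (before-run p d (arm s d)
            (subst (p endpointOf_) (trans (sym eqa) (after-nth i)) (spoke-endpoint p (flip d) (arm s (flip d)))) eqb k k≤i)
          (∈ₚ-nth _))
        λ e∈ → [ id , (λ (_ , _ , eq) → contradiction (proj₁ (at-injective {d} eq)) (d≢flip d)) ]′
                 (bent-cases p d (arm s d) (arm s (flip d)) eqb eqa e∈))
      (run⇒Arm (joints ∸ suc (toℕ i))
        (λ k k≤N → subst (_∈ₚ P)
          (after-run p (flip d) (arm s (flip d))
            (subst (p endpointOf_) (trans (sym eqb) (before-nth i)) (spoke-endpoint p d (arm s d))) eqa k k≤N)
          (∈ₚ-nth _))
        λ e∈ → [ (λ (_ , _ , eq) → contradiction (sym (proj₁ (at-injective {flip d} eq))) (d≢flip d)) , id ]′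
                 (bent-cases p d (arm s d) (arm s (flip d)) eqb eqa e∈))

    bent-hook : ∀ {K : Point → Shape → Set} p s d → K p s →
                before i ≡ spoke p d (arm s d) → after i ≡ spoke p (flip d) (arm s (flip d)) →
                IsHook K (_∈ₚ P)
    bent-hook p s d k eqb eqa = arms⇒hook p s (bent-arms p s d eqb eqa) λ _ _ → k

  module _ (no-bend : ∀ i → ¬ IsBend i) where

    straight-run : ∀ d σ {l a} → nthEdge 0 ≡ at d l a →
                   (0 ℕ.< joints → ¬ point d l (entry σ a) endpointOf nthEdge 1) →
                   ∀ k → k ℕ.≤ joints → nthEdge k ≡ at d l (walk σ a k)
    straight-run d σ = run nthEdge joints d σ
      (λ k k<n → nth-direction k k<n (λ i _ → no-bend i))
      (λ k k<n → let q , c , _ = nth-touch k k<n in q , c)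
      (λ k k<n → nth-skip k _ k<n (ℕ.n<1+n _))

    -- The end shared with the second edge is where the path leaves the first edge, and uniqueness
    -- of the shared point excludes the other end. For a single edge `upper` is an arbitrary choice.
    orientation : ∀ d l a → nthEdge 0 ≡ at d l a →
                  ∃[ σ ] (0 ℕ.< joints → ¬ point d l (entry σ a) endpointOf nthEdge 1)
    orientation d l a eq with 0 ℕ.<? joints
    ... | no 0≮n = upper , λ 0<n → contradiction 0<n 0≮n
    ... | yes 0<n with nth-touch 0 0<n
    ... | q , (q₀ , _) , unique with ends-of d (subst (q endpointOf_) eq q₀)
    ... | inj₁ refl = lower , λ _ on₁ →
      ℤ.i≢suc[i] (sym (proj₂ (point-injective d
        (unique _ (subst (_ endpointOf_) (sym eq) (entry-endpoint d lower) , on₁)))))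
    ... | inj₂ refl = upper , λ _ on₁ →
      ℤ.i≢suc[i] (proj₂ (point-injective d
        (unique _ (subst (_ endpointOf_) (sym eq) (entry-endpoint d upper) , on₁))))

    -- Valid for every `K`: all edges have one direction, so `corner` is vacuous.
    straight-hook : ∀ {K} → IsHook K (_∈ₚ P)
    straight-hook with as-at (nthEdge 0)
    ... | l , a , eq with direction (nthEdge 0)
    ... | d with orientation d l a eq
    ... | σ , out = record { line = line′ ; convex = convex′ ; corner = corner′ }
      where
      covered : ∀ {e} → e ∈ₚ P → ∃[ k ] (k ℕ.≤ joints × e ≡ at d l (walk σ a k))
      covered e∈ with nth-∈ₚ e∈
      ... | k , k≤n , refl = k , k≤n , straight-run d σ eq out k k≤n
      arm′ : Arm (_∈ₚ P) d l σ (entry σ a)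
      arm′ = run⇒Arm joints
        (λ k k≤n → subst (_∈ₚ P) (trans (straight-run d σ eq out k k≤n) (sym (walk-near k))) (∈ₚ-nth k))
        (λ e∈ → let k , k≤n , eq′ = covered e∈ in k , k≤n , trans eq′ (sym (walk-near k)))
        where
        walk-near : ∀ k → at d l (walk σ (near σ (entry σ a)) k) ≡ at d l (walk σ a k)
        walk-near k = cong (λ b → at d l (walk σ b k)) (near-entry σ a)
      on-line : ∀ {d′ k b} → at d′ k b ∈ₚ P → d′ ≡ d × k ≡ l
      on-line e∈ with covered e∈
      ... | _ , _ , eq′ with at-injective eq′
      ... | eqd , eql , _ = eqd , eql
      line′ : ∀ d′ {k m x y} → at d′ k x ∈ₚ P → at d′ m y ∈ₚ P → k ≡ m
      line′ d′ sx sy = trans (proj₂ (on-line {d′} sx)) (sym (proj₂ (on-line {d′} sy)))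
      convex′ : ∀ d′ {k x y z} → at d′ k x ∈ₚ P → at d′ k z ∈ₚ P →
                x ℤ.≤ y → y ℤ.≤ z → at d′ k y ∈ₚ P
      convex′ d′ sx sz p q with on-line {d′} sx
      ... | refl , _ = filled≤ σ arm′ sx sz p q
      corner′ : ∀ d′ {k m x y} → at d′ k x ∈ₚ P → at (flip d′) m y ∈ₚ P → _
      corner′ d′ sx sy =
        contradiction (trans (proj₁ (on-line {d′} sx)) (sym (proj₁ (on-line {flip d′} sy)))) (d≢flip d′)

  -- `BendHasShape` with its point exposed, so that the allowed shapes may depend on the place of
  -- the bend.
  BendsAt : Fin joints → Point → Shape → Set
  BendsAt i p s = (before i ≡ leaving p (horizontalArm s) × after i ≡ leaving p (verticalArm s))
                ⊎ (before i ≡ leaving p (verticalArm s) × after i ≡ leaving p (horizontalArm s))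

  Bends : (Point → Shape → Set) → Set
  Bends K = (∀ i → ¬ IsBend i) ⊎ (∃[ i ] (IsBend i × ∃₂ λ p s → K p s × BendsAt i p s))

  path-hook : ∀ {K} → AtMostOneBend → Bends K → IsHook K (_∈ₚ P)
  path-hook one-bend (inj₁ no-bend) = straight-hook no-bend
  path-hook one-bend (inj₂ (i , bend , p , s , k , inj₁ (eqb , eqa))) =
    bent-hook one-bend i bend p s horizontal k
      (trans eqb (leaving-horizontal p s)) (trans eqa (leaving-vertical p s))
  path-hook one-bend (inj₂ (i , bend , p , s , k , inj₂ (eqb , eqa))) =
    bent-hook one-bend i bend p s vertical k
      (trans eqb (leaving-vertical p s)) (trans eqa (leaving-horizontal p s))

  shape-bends : ∀ {s} → P HasShape s → Bends (λ _ → s ≡_)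
  shape-bends (inj₁ (no-bend , _))       = inj₁ no-bend
  shape-bends (inj₂ (i , bend , p , eq)) = inj₂ (i , bend , p , _ , refl , eq)

  bends : Bends (λ _ _ → ⊤)
  bends with Fin.any? (λ i → ¬? (direction (before i) ≟ᵈ direction (after i)))
  ... | no none = inj₁ λ i bend → none (i , bend)
  ... | yes (i , bend) = inj₂ (i , bend , turning (consecutive i) bend)
    where
    turning : ∀ {e f} → ShareExactlyOnePoint e f → direction e ≢ direction f →
              ∃₂ λ p s → ⊤ × ((e ≡ leaving p (horizontalArm s) × f ≡ leaving p (verticalArm s))
                             ⊎ (e ≡ leaving p (verticalArm s) × f ≡ leaving p (horizontalArm s)))
    turning (p , (p∈e , p∈f) , _) e≢f with endpoint-spoke p∈e | endpoint-spoke p∈f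
    ... | horizontal , σ , refl | horizontal , τ , refl = contradiction refl e≢f
    ... | horizontal , σ , refl | vertical , τ , refl with shape σ τ
    ... | s , refl , refl = p , s , _ , inj₁ (sym (leaving-horizontal p s) , sym (leaving-vertical p s))
    turning (p , (p∈e , p∈f) , _) e≢f | vertical , τ , refl | horizontal , σ , refl with shape σ τ
    ... | s , refl , refl = p , s , _ , inj₂ (sym (leaving-vertical p s) , sym (leaving-horizontal p s))
    turning (p , (p∈e , p∈f) , _) e≢f | vertical , σ , refl | vertical , τ , refl = contradiction refl e≢f

-- Separating graphs

_≟ᵉ_ : (e f : GridEdge) → Dec (e ≡ f)
edge p d ≟ᵉ edge q c = map′ (λ { (refl , refl) → refl }) (λ { refl → refl , refl })
  (≡-dec ℤ._≟_ ℤ._≟_ p q ×-dec d ≟ᵈ c)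

_endpointOf?_ : ∀ p e → Dec (p endpointOf e)
p endpointOf? e = ≡-dec ℤ._≟_ ℤ._≟_ p (origin e) ⊎-dec ≡-dec ℤ._≟_ ℤ._≟_ p (target e)

-- Decidable replacements for `ShareExactlyOnePoint` and `ShareNoPoint`, which quantify over all
-- points; testing the two ends of `e` suffices.
OneEndOn NoEndOn : GridEdge → GridEdge → Set
OneEndOn e f = (origin e endpointOf f × ¬ target e endpointOf f)
             ⊎ (target e endpointOf f × ¬ origin e endpointOf f)
NoEndOn e f = ¬ origin e endpointOf f × ¬ target e endpointOf f

oneEndOn? : ∀ e f → Dec (OneEndOn e f)
oneEndOn? e f = (origin e endpointOf? f ×-dec ¬? (target e endpointOf? f))
          ⊎-dec (target e endpointOf? f ×-dec ¬? (origin e endpointOf? f))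

noEndOn? : ∀ e f → Dec (NoEndOn e f)
noEndOn? e f = ¬? (origin e endpointOf? f) ×-dec ¬? (target e endpointOf? f)

one-end-shared : ∀ {e f} → OneEndOn e f → ShareExactlyOnePoint e f
one-end-shared (inj₁ (o , ¬t)) = _ , (inj₁ refl , o) , λ
  { _ (inj₁ refl , _) → refl ; _ (inj₂ refl , t) → contradiction t ¬t }
one-end-shared (inj₂ (t , ¬o)) = _ , (inj₂ refl , t) , λ
  { _ (inj₁ refl , o) → contradiction o ¬o ; _ (inj₂ refl , _) → refl }

no-end-shared : ∀ {e f} → NoEndOn e f → ShareNoPoint e f
no-end-shared (¬o , ¬t) _ (inj₁ refl , o) = ¬o o
no-end-shared (¬o , ¬t) _ (inj₂ refl , t) = ¬t t

IsPath : ∀ {n} → Vec GridEdge (suc n) → Set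
IsPath es = (∀ i j → lookup es i ≡ lookup es j → i ≡ j)
          × (∀ i → OneEndOn (lookup es (inject₁ i)) (lookup es (suc i)))
          × (∀ i j → suc (toℕ i) ℕ.< toℕ j → NoEndOn (lookup es i) (lookup es j))

isPath? : ∀ {n} (es : Vec GridEdge (suc n)) → Dec (IsPath es)
isPath? es = Fin.all? (λ i → Fin.all? λ j → (lookup es i ≟ᵉ lookup es j) →-dec (i Fin.≟ j))
       ×-dec Fin.all? (λ i → oneEndOn? _ _)
       ×-dec Fin.all? (λ i → Fin.all? λ j → (suc (toℕ i) ℕ.<? toℕ j) →-dec noEndOn? _ _)

fromEdges : ∀ {n} (es : Vec GridEdge (suc n)) {_ : True (isPath? es)} → Path
fromEdges es {valid} = record
  { edgeAt = lookup es
  ; distinct = λ {i} {j} → proj₁ (toWitness valid) i j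
  ; consecutive = λ i → one-end-shared (proj₁ (proj₂ (toWitness valid)) i)
  ; nonconsecutive = λ i j i<j → no-end-shared (proj₂ (proj₂ (toWitness valid)) i j i<j)
  }

atMostOneBend? : ∀ P → Dec (Path.AtMostOneBend P)
atMostOneBend? P = Fin.all? λ i → Fin.all? λ j → bend? i →-dec (bend? j →-dec (i Fin.≟ j))
  where
  open Path P
  bend? : ∀ i → Dec (IsBend i)
  bend? i = ¬? (direction (before i) ≟ᵈ direction (after i))

shareEdge? : ∀ P Q → Dec (ShareEdge P Q)
shareEdge? P Q = map′ (λ (i , j , eq) → _ , (i , refl) , (j , eq))
  (λ { (_ , (i , refl) , (j , eq)) → i , j , eq })
  (Fin.any? λ i → Fin.any? λ j → Path.edgeAt Q j ≟ᵉ Path.edgeAt P i)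

-- Separating graphs are given by a representation, so membership in one class is by construction,
-- and adjacency is decided by computation.
intersectionGraph : ∀ {n} → (Fin n → Path) → Graph
intersectionGraph {n} P = record
  { order  = n
  ; Adj    = λ u v → u ≢ v × ShareEdge (P u) (P v)
  ; sym    = λ (u≢v , e , eu , ev) → (u≢v ∘ sym) , e , ev , eu
  ; irrefl = λ u≡v (u≢v , _) → u≢v u≡v
  ; adj?   = λ u v → ¬? (u Fin.≟ v) ×-dec shareEdge? (P u) (P v)
  }

representation : ∀ {n} (P : Fin n → Path) → EPG (intersectionGraph P)
representation P = record
  { path = P
  ; adjacency = λ u v u≢v → mk⇔ proj₂ (u≢v ,_)
  }

hor ver : ℤ → ℤ → GridEdge
hor x y = edge (x , y) horizontal
ver x y = edge (x , y) vertical

-- From adjacency in the graph to meeting and disjoint hooks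

module Representation {G : Graph} (R : EPG G) where
  open Graph G
  open EPG R

  edges : Vertex → Pred GridEdge 0ℓ
  edges v = _∈ₚ path v

  NonAdj : Vertex → Vertex → Set
  NonAdj u v = u ≢ v × ¬ Adj u v

  nonAdj? : ∀ u v → Dec (NonAdj u v)
  nonAdj? u v = ¬? (u Fin.≟ v) ×-dec ¬? (adj? u v)

  adj⇒meets : ∀ {u v} → Adj u v → Meets (edges u) (edges v)
  adj⇒meets {u} {v} uv = Equivalence.to (adjacency u v λ u≡v → irrefl u≡v uv) uv

  nonAdj⇒apart : ∀ {u v} → NonAdj u v → Apart (edges u) (edges v)
  nonAdj⇒apart {u} {v} (u≢v , ¬uv) e eu ev = ¬uv (Equivalence.from (adjacency u v u≢v) (e , eu , ev))

  meets : ∀ u v {_ : True (adj? u v)} → Meets (edges u) (edges v)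
  meets u v {uv} = adj⇒meets (toWitness uv)

  apart : ∀ u v {_ : True (nonAdj? u v)} → Apart (edges u) (edges v)
  apart u v {uv} = nonAdj⇒apart (toWitness uv)

  Clique : Subset order → Set
  Clique F = ∀ u v → u ∈ F → v ∈ F → u ≢ v → Adj u v

  clique? : ∀ F → Dec (Clique F)
  clique? F = Fin.all? λ u → Fin.all? λ v →
    (u ∈? F) →-dec ((v ∈? F) →-dec (¬? (u Fin.≟ v) →-dec adj? u v))

  common-edge : Helly → ∀ F {_ : True (clique? F)} → ∃[ e ] (∀ u → u ∈ F → e ∈ₚ path u)
  common-edge helly F {cl} = helly F λ u v u∈ v∈ u≢v → adj⇒meets (toWitness cl u v u∈ v∈ u≢v)

  -- An induced `K₂,₃` with parts `a`, `b` and `c`, `d`, `e`.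
  Linked : (a b c d e : Vertex) → Set
  Linked a b c d e = NonAdj a b × (NonAdj c d × NonAdj c e × NonAdj d e) × (Adj a c × Adj b c)
                   × (Adj a d × Adj b d) × (Adj a e × Adj b e)

  linked? : ∀ a b c d e → Dec (Linked a b c d e)
  linked? a b c d e = nonAdj? a b ×-dec (nonAdj? c d ×-dec nonAdj? c e ×-dec nonAdj? d e)
                ×-dec (adj? a c ×-dec adj? b c)
                ×-dec (adj? a d ×-dec adj? b d) ×-dec (adj? a e ×-dec adj? b e)

  linked : ∀ {K} → (∀ v → IsHook K (edges v)) → ∀ a b c d e {_ : True (linked? a b c d e)} →
           ∃[ δ ] Link δ (flip δ) (edges a) (edges b) (edges c)
  linked hook a b c d e {w} =
    let ab , (cd , ce , de) , (ac , bc) , (ad , bd) , (ae , be) = toWitness w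
    in crossing (hook a) (hook b) (hook c) (hook d) (hook e) (nonAdj⇒apart ab)
         (nonAdj⇒apart cd) (nonAdj⇒apart ce) (nonAdj⇒apart de) (adj⇒meets ac) (adj⇒meets bc)
         (adj⇒meets ad) (adj⇒meets bd) (adj⇒meets ae) (adj⇒meets be)

  hooks : B₁ → ∀ {K} → (∀ v → Bends (path v) K) → ∀ v → IsHook K (edges v)
  hooks b₁ bs v = path-hook (path v) (b₁ v) (bs v)

  hooks-of-shapes : B₁ → ∀ {S} → ShapesIn S → ∀ v → IsHook (λ _ → S) (edges v)
  hooks-of-shapes b₁ shapes v with shapes v
  ... | s , s∈S , has = weaken (λ { refl → s∈S }) (path-hook (path v) (b₁ v) (shape-bends (path v) has))

  clawfree⇒Helly : ∀ {K} → Clawfree K → (∀ v → IsHook K (edges v)) → Helly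
  clawfree⇒Helly K! hook = Helly-family K! edges hook λ v → _ , zero , refl

-- Pairs of opposite shapes

diagonal : Shape → Bool
diagonal ⌞ = true
diagonal ⌝ = true
diagonal ⌟ = false
diagonal ⌜ = false

-- At each point `δ` selects one pair of opposite shapes, and opposite shapes have no arm in common.
-- The pair may vary with the point.
diagonal-clawfree : (δ : Point → Bool) → Clawfree (λ p s → diagonal s ≡ δ p)
diagonal-clawfree δ = record { unique-arm = λ d p q → unique d (trans p (sym q)) }
  where
  unique : ∀ d {s t} → diagonal s ≡ diagonal t → arm s d ≡ arm t d → s ≡ t
  unique horizontal {⌞} {⌞} _ _ = refl
  unique horizontal {⌝} {⌝} _ _ = refl
  unique horizontal {⌟} {⌟} _ _ = refl
  unique horizontal {⌜} {⌜} _ _ = refl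
  unique vertical   {⌞} {⌞} _ _ = refl
  unique vertical   {⌝} {⌝} _ _ = refl
  unique vertical   {⌟} {⌟} _ _ = refl
  unique vertical   {⌜} {⌜} _ _ = refl

-- The 3-sun

sunPath : Fin 6 → Path
sunPath = lookup
  ( fromEdges (ver 0ℤ -1ℤ ∷ ver 0ℤ 0ℤ ∷ [])
  ∷ fromEdges (ver 0ℤ 0ℤ ∷ hor 0ℤ 0ℤ ∷ [])
  ∷ fromEdges (ver 0ℤ -1ℤ ∷ hor 0ℤ 0ℤ ∷ [])
  ∷ fromEdges (ver 0ℤ 0ℤ ∷ [])
  ∷ fromEdges (ver 0ℤ -1ℤ ∷ [])
  ∷ fromEdges (hor 0ℤ 0ℤ ∷ [])
  ∷ [])

-- Paths 0, 1, 2 form a claw at the origin. Paths 3, 4, 5 are its single edges, each adjacent to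
-- exactly two of the first three.
sun : Graph
sun = intersectionGraph sunPath

sun∈[⌞⌜] : B₁-EPG[ ｛ ⌞ ｝ ∪ ｛ ⌜ ｝ ] sun
sun∈[⌞⌜] = representation sunPath , from-yes (Fin.all? (atMostOneBend? ∘ sunPath)) , shapes
  where
  shapes : EPG.ShapesIn (representation sunPath) (｛ ⌞ ｝ ∪ ｛ ⌜ ｝)
  shapes zero = ⌞ , inj₁ refl , inj₁ ((λ { zero b → b refl }) , refl)
  shapes (suc zero) = ⌞ , inj₁ refl , inj₂ (zero , (λ ()) , (0ℤ , 0ℤ) , inj₂ (refl , refl))
  shapes (suc (suc zero)) = ⌜ , inj₂ refl , inj₂ (zero , (λ ()) , (0ℤ , 0ℤ) , inj₂ (refl , refl))
  shapes (suc (suc (suc zero))) = ⌞ , inj₁ refl , inj₁ ((λ ()) , refl)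
  shapes (suc (suc (suc (suc zero)))) = ⌞ , inj₁ refl , inj₁ ((λ ()) , refl)
  shapes (suc (suc (suc (suc (suc zero))))) = ⌞ , inj₁ refl , inj₁ ((λ ()) , refl)

-- The Helly property is applied to the central triangle and the three outer ones. An edge common to
-- an outer triangle avoids the third central path, which is not adjacent to the outer vertex.
sun∉Helly : ¬ Helly-B₁-EPG sun
sun∉Helly (R , b₁ , helly) =
  let e , e∈ = common-edge helly (inside ∷ inside ∷ inside ∷ outside ∷ outside ∷ outside ∷ [])
      f , f∈ = common-edge helly (inside ∷ inside ∷ outside ∷ inside ∷ outside ∷ outside ∷ [])
      g , g∈ = common-edge helly (inside ∷ outside ∷ inside ∷ outside ∷ inside ∷ outside ∷ [])
      h , h∈ = common-edge helly (outside ∷ inside ∷ inside ∷ outside ∷ outside ∷ inside ∷ [])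
      hook = hooks b₁ λ v → bends (EPG.path R v)
  in no-sun (hook x) (hook y) (hook z)
       (e∈ x here) (e∈ y (there here)) (e∈ z (there (there here)))
       (f∈ x here) (f∈ y (there here)) (apart (# 3) z f (f∈ (# 3) (there (there (there here)))))
       (g∈ x here) (g∈ z (there (there here))) (apart (# 4) y g (g∈ (# 4) (there (there (there (there here))))))
       (h∈ y (there here)) (h∈ z (there (there here)))
       (apart (# 5) x h (h∈ (# 5) (there (there (there (there (there here)))))))
  where
  open Representation R
  x y z : Fin 6
  x = # 0
  y = # 1
  z = # 2

-- K₂,₃ with parts {0, 1} and {2, 3, 4}

K₂₃Path : Fin 5 → Path
K₂₃Path = lookup
  ( fromEdges (ver 0ℤ 1ℤ ∷ ver 0ℤ 0ℤ ∷ hor 0ℤ 0ℤ ∷ hor 1ℤ 0ℤ ∷ [])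
  ∷ fromEdges (ver 1ℤ -1ℤ ∷ ver 1ℤ 0ℤ ∷ hor 0ℤ 1ℤ ∷ hor -1ℤ 1ℤ ∷ [])
  ∷ fromEdges (ver 1ℤ 0ℤ ∷ hor 1ℤ 0ℤ ∷ [])
  ∷ fromEdges (ver 1ℤ -1ℤ ∷ hor 0ℤ 0ℤ ∷ [])
  ∷ fromEdges (ver 0ℤ 1ℤ ∷ hor 0ℤ 1ℤ ∷ [])
  ∷ [])

K₂₃ : Graph
K₂₃ = intersectionGraph K₂₃Path

K₂₃∈[⌞⌝] : B₁-EPG[ ｛ ⌞ ｝ ∪ ｛ ⌝ ｝ ] K₂₃
K₂₃∈[⌞⌝] = representation K₂₃Path , from-yes (Fin.all? (atMostOneBend? ∘ K₂₃Path)) , shapes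
  where
  shapes : EPG.ShapesIn (representation K₂₃Path) (｛ ⌞ ｝ ∪ ｛ ⌝ ｝)
  shapes zero                         = ⌞ , inj₁ refl , inj₂ (# 1 , (λ ()) , (0ℤ , 0ℤ) , inj₂ (refl , refl))
  shapes (suc zero)                   = ⌝ , inj₂ refl , inj₂ (# 1 , (λ ()) , (1ℤ , 1ℤ) , inj₂ (refl , refl))
  shapes (suc (suc zero))             = ⌞ , inj₁ refl , inj₂ (# 0 , (λ ()) , (1ℤ , 0ℤ) , inj₂ (refl , refl))
  shapes (suc (suc (suc zero)))       = ⌝ , inj₂ refl , inj₂ (# 0 , (λ ()) , (1ℤ , 0ℤ) , inj₂ (refl , refl))
  shapes (suc (suc (suc (suc zero)))) = ⌞ , inj₁ refl , inj₂ (# 0 , (λ ()) , (0ℤ , 1ℤ) , inj₂ (refl , refl))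

-- Two of the three crossing links have the same kind, whereas `⌞` admits only one of each.
K₂₃∉[⌞] : ¬ B₁-EPG[ ｛ ⌞ ｝ ] K₂₃
K₂₃∉[⌞] (R , b₁ , shapes) = finish (linked hook a b c d e) (linked hook a b d c e) (linked hook a b e c d)
  where
  open Representation R
  hook = hooks-of-shapes b₁ shapes
  a b c d e : Fin 5
  a = # 0
  b = # 1
  c = # 2
  d = # 3
  e = # 4
  ab-links : Direction → Fin 5 → Set
  ab-links δ v = Link δ (flip δ) (edges a) (edges b) (edges v)
  one-each : ∀ δ u v {_ : True (nonAdj? u v)} → ab-links δ u → ¬ ab-links δ v
  one-each δ u v {w} = no-two-crossings δ (hook a) (hook b) (hook u) (hook v) (nonAdj⇒apart (toWitness w))
  finish : ∃[ δ ] ab-links δ c → ∃[ δ ] ab-links δ d → ∃[ δ ] ab-links δ e → ⊥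
  finish (horizontal , C) (horizontal , D) _ = one-each horizontal c d C D
  finish (vertical   , C) (vertical   , D) _ = one-each vertical c d C D
  finish (horizontal , C) _ (horizontal , E) = one-each horizontal c e C E
  finish (vertical   , C) _ (vertical   , E) = one-each vertical c e C E
  finish _ (horizontal , D) (horizontal , E) = one-each horizontal d e D E
  finish _ (vertical   , D) (vertical   , E) = one-each vertical d e D E

-- Vertices 0 and 1 against 2, 3, 4, 5 form a K₂,₄; the remaining vertices force that
-- 2 and 3, or else 3 and 4, are opposite corners of a rectangle.

framePath : Fin 10 → Path
framePath = lookup
  ( fromEdges (ver 0ℤ 1ℤ ∷ ver 0ℤ 0ℤ ∷ hor 0ℤ 0ℤ ∷ hor 1ℤ 0ℤ ∷ [])
  ∷ fromEdges (ver 1ℤ -1ℤ ∷ ver 1ℤ 0ℤ ∷ hor 0ℤ 1ℤ ∷ hor -1ℤ 1ℤ ∷ [])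
  ∷ fromEdges (ver 1ℤ 0ℤ ∷ hor 0ℤ 0ℤ ∷ [])
  ∷ fromEdges (ver 0ℤ 0ℤ ∷ hor 0ℤ 1ℤ ∷ [])
  ∷ fromEdges (ver 0ℤ 1ℤ ∷ hor -1ℤ 1ℤ ∷ [])
  ∷ fromEdges (ver 1ℤ -1ℤ ∷ hor 1ℤ 0ℤ ∷ [])
  ∷ fromEdges (ver 0ℤ 0ℤ ∷ hor 0ℤ 0ℤ ∷ [])
  ∷ fromEdges (ver 1ℤ 0ℤ ∷ hor 0ℤ 1ℤ ∷ [])
  ∷ fromEdges (ver 0ℤ 1ℤ ∷ ver 0ℤ 0ℤ ∷ [])
  ∷ fromEdges (hor 0ℤ 1ℤ ∷ hor -1ℤ 1ℤ ∷ [])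
  ∷ [])

frame : Graph
frame = intersectionGraph framePath

-- All four shapes occur, with bends at the corners of the unit square, but only `⌞` and `⌝` where
-- `x` equals `y` and only `⌟` and `⌜` at the other two corners.
frame∈Helly : Helly-B₁-EPG frame
frame∈Helly = R , b₁ , clawfree⇒Helly (diagonal-clawfree δ) (hooks b₁ frame-bends)
  where
  R = representation framePath
  open Representation R
  b₁ = from-yes (Fin.all? (atMostOneBend? ∘ framePath))
  δ : Point → Bool
  δ (x , y) = does (x ℤ.≟ y)
  frame-bends : ∀ v → Bends (framePath v) (λ p s → diagonal s ≡ δ p)
  frame-bends zero                         = inj₂ (# 1 , (λ ()) , (0ℤ , 0ℤ) , ⌞ , refl , inj₂ (refl , refl))
  frame-bends (suc zero)                   = inj₂ (# 1 , (λ ()) , (1ℤ , 1ℤ) , ⌝ , refl , inj₂ (refl , refl))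
  frame-bends (suc (suc zero))             = inj₂ (# 0 , (λ ()) , (1ℤ , 0ℤ) , ⌟ , refl , inj₂ (refl , refl))
  frame-bends (suc (suc (suc zero)))       = inj₂ (# 0 , (λ ()) , (0ℤ , 1ℤ) , ⌜ , refl , inj₂ (refl , refl))
  frame-bends (suc (suc (suc (suc zero)))) = inj₂ (# 0 , (λ ()) , (0ℤ , 1ℤ) , ⌟ , refl , inj₂ (refl , refl))
  frame-bends (suc (suc (suc (suc (suc zero))))) =
    inj₂ (# 0 , (λ ()) , (1ℤ , 0ℤ) , ⌜ , refl , inj₂ (refl , refl))
  frame-bends (suc (suc (suc (suc (suc (suc zero)))))) =
    inj₂ (# 0 , (λ ()) , (0ℤ , 0ℤ) , ⌞ , refl , inj₂ (refl , refl))
  frame-bends (suc (suc (suc (suc (suc (suc (suc zero))))))) =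
    inj₂ (# 0 , (λ ()) , (1ℤ , 1ℤ) , ⌝ , refl , inj₂ (refl , refl))
  frame-bends (suc (suc (suc (suc (suc (suc (suc (suc zero)))))))) = inj₁ λ { zero b → b refl }
  frame-bends (suc (suc (suc (suc (suc (suc (suc (suc (suc zero))))))))) = inj₁ λ { zero b → b refl }

frame∉[⌞⌜⌝] : ¬ B₁-EPG[ ｛ ⌞ ｝ ∪ ｛ ⌜ ｝ ∪ ｛ ⌝ ｝ ] frame
frame∉[⌞⌜⌝] (R , b₁ , shapes) =
  finish (linked hook a b c₁ c₂ c₃) (linked hook a b c₂ c₁ c₃)
         (linked hook a b c₃ c₁ c₂) (linked hook a b c₄ c₁ c₂)
  where
  open Representation R
  a b c₁ c₂ c₃ c₄ d e d′ e′ : Fin 10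
  a = # 0
  b = # 1
  c₁ = # 2
  c₂ = # 3
  c₃ = # 4
  c₄ = # 5
  d = # 6
  e = # 7
  d′ = # 8
  e′ = # 9
  hook : ∀ v → IsHook (λ _ s → s ≢ ⌟) (edges v)
  hook v = weaken (λ { (inj₁ refl) () ; (inj₂ (inj₁ refl)) () ; (inj₂ (inj₂ refl)) () })
           (hooks-of-shapes b₁ shapes v)
  ab-links : Direction → Fin 10 → Set
  ab-links δ v = Link δ (flip δ) (edges a) (edges b) (edges v)

  not-three : ∀ δ u v w {_ : True (nonAdj? u v ×-dec nonAdj? u w ×-dec nonAdj? v w)} →
              ab-links δ u → ab-links δ v → ¬ ab-links δ w
  not-three δ u v w {x} = let uv , uw , vw = toWitness x in
    no-three-crossings δ (hook a) (hook b) (hook u) (hook v) (hook w)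
      (nonAdj⇒apart uv) (nonAdj⇒apart uw) (nonAdj⇒apart vw)

  Framed : (c p c′ p′ d e : Fin 10) → Set
  Framed c p c′ p′ d e = (NonAdj c p × NonAdj c′ p′)
    × (Graph.Adj frame d a × Graph.Adj frame d c × Graph.Adj frame d c′ × NonAdj d p × NonAdj d p′)
    × (Graph.Adj frame e b × Graph.Adj frame e c × Graph.Adj frame e c′ × NonAdj e p × NonAdj e p′)

  framed? : ∀ c p c′ p′ d e → Dec (Framed c p c′ p′ d e)
  framed? c p c′ p′ d e = (nonAdj? c p ×-dec nonAdj? c′ p′)
    ×-dec (adj? d a ×-dec adj? d c ×-dec adj? d c′ ×-dec nonAdj? d p ×-dec nonAdj? d p′)
    ×-dec (adj? e b ×-dec adj? e c ×-dec adj? e c′ ×-dec nonAdj? e p ×-dec nonAdj? e p′)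
    where open Graph frame using (adj?)

  framed : ∀ c p c′ p′ d e {_ : True (framed? c p c′ p′ d e)} →
           ab-links horizontal c → ab-links horizontal p → ab-links vertical c′ → ¬ ab-links vertical p′
  framed c p c′ p′ d e {w} (_ , _ , C) P (_ , _ , C′) P′ =
    let (cp , cp′) , (da , dc , dc′ , dp , dp′) , (eb , ec , ec′ , ep , ep′) = toWitness w
    in no-frame (hook a) (hook b) (hook c) (hook p) (hook c′) (hook p′) (hook d) (hook e)
         (C , aligned horizontal (hook a) (hook b) C P , nonAdj⇒apart cp)
         (C′ , aligned vertical (hook a) (hook b) C′ P′ , nonAdj⇒apart cp′)
         (adj⇒meets da) (adj⇒meets dc) (adj⇒meets dc′) (nonAdj⇒apart dp) (nonAdj⇒apart dp′)
         (adj⇒meets eb) (adj⇒meets ec) (adj⇒meets ec′) (nonAdj⇒apart ep) (nonAdj⇒apart ep′)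

  finish : ∃[ δ ] ab-links δ c₁ → ∃[ δ ] ab-links δ c₂ → ∃[ δ ] ab-links δ c₃ → ∃[ δ ] ab-links δ c₄ → ⊥
  -- Three links of one kind are impossible, so the four links split two and two.
  finish (horizontal , L₁) (horizontal , L₂) (horizontal , L₃) _ = not-three horizontal c₁ c₂ c₃ L₁ L₂ L₃
  finish (horizontal , L₁) (horizontal , L₂) _ (horizontal , L₄) = not-three horizontal c₁ c₂ c₄ L₁ L₂ L₄
  finish (horizontal , L₁) _ (horizontal , L₃) (horizontal , L₄) = not-three horizontal c₁ c₃ c₄ L₁ L₃ L₄
  finish _ (horizontal , L₂) (horizontal , L₃) (horizontal , L₄) = not-three horizontal c₂ c₃ c₄ L₂ L₃ L₄
  finish (vertical , L₁) (vertical , L₂) (vertical , L₃) _ = not-three vertical c₁ c₂ c₃ L₁ L₂ L₃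
  finish (vertical , L₁) (vertical , L₂) _ (vertical , L₄) = not-three vertical c₁ c₂ c₄ L₁ L₂ L₄
  finish (vertical , L₁) _ (vertical , L₃) (vertical , L₄) = not-three vertical c₁ c₃ c₄ L₁ L₃ L₄
  finish _ (vertical , L₂) (vertical , L₃) (vertical , L₄) = not-three vertical c₂ c₃ c₄ L₂ L₃ L₄
  -- `c₁` and `c₂` are of different kinds; `d` and `e` join them to `a` and `b`.
  finish (horizontal , L₁) (vertical , L₂) (horizontal , L₃) (vertical , L₄) = framed c₁ c₃ c₂ c₄ d e L₁ L₃ L₂ L₄
  finish (horizontal , L₁) (vertical , L₂) (vertical , L₃) (horizontal , L₄) = framed c₁ c₄ c₂ c₃ d e L₁ L₄ L₂ L₃
  finish (vertical , L₁) (horizontal , L₂) (horizontal , L₃) (vertical , L₄) = framed c₂ c₃ c₁ c₄ d e L₂ L₃ L₁ L₄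
  finish (vertical , L₁) (horizontal , L₂) (vertical , L₃) (horizontal , L₄) = framed c₂ c₄ c₁ c₃ d e L₂ L₄ L₁ L₃
  -- `c₁` and `c₂` agree, so `c₂` and `c₃` differ; `d′` and `e′` join these to `a` and `b`.
  finish (horizontal , L₁) (horizontal , L₂) (vertical , L₃) (vertical , L₄) = framed c₂ c₁ c₃ c₄ d′ e′ L₂ L₁ L₃ L₄
  finish (vertical , L₁) (vertical , L₂) (horizontal , L₃) (horizontal , L₄) = framed c₃ c₄ c₂ c₁ d′ e′ L₃ L₄ L₂ L₁

-- Inclusions and separations

⌞⌝⇒Helly : B₁-EPG[ ｛ ⌞ ｝ ∪ ｛ ⌝ ｝ ] ⊆ Helly-B₁-EPG
-- `⌞` and `⌝` are opposite, so the constant choice of pair shows that the given representation is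
-- itself Helly.
⌞⌝⇒Helly (R , b₁ , shapes) = R , b₁ , clawfree⇒Helly (diagonal-clawfree λ _ → true)
    λ v → weaken (λ { (inj₁ refl) → refl ; (inj₂ refl) → refl }) (hooks-of-shapes b₁ shapes v)
  where open Representation R

widen : ∀ {S T G} → S ⊆ T → B₁-EPG[ S ] G → B₁-EPG[ T ] G
widen S⊆T (R , b₁ , shapes) = R , b₁ , λ v → let s , s∈S , has = shapes v in s , S⊆T s∈S , has

theorem2p1 : (B₁-EPG[ ｛ ⌞ ｝ ] ⊂ B₁-EPG[ ｛ ⌞ ｝ ∪ ｛ ⌝ ｝ ])
    × (B₁-EPG[ ｛ ⌞ ｝ ∪ ｛ ⌝ ｝ ] ⊂ Helly-B₁-EPG)
    × Incomparable Helly-B₁-EPG B₁-EPG[ ｛ ⌞ ｝ ∪ ｛ ⌜ ｝ ]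
    × Incomparable Helly-B₁-EPG B₁-EPG[ ｛ ⌞ ｝ ∪ ｛ ⌜ ｝ ∪ ｛ ⌝ ｝ ]
theorem2p1 =
    (widen inj₁ , λ ⊇ → K₂₃∉[⌞] (⊇ K₂₃∈[⌞⌝]))
  -- The frame lies outside the class of all three shapes, hence outside its subclasses, and settles
  -- three separations; the sun settles the two converse ones.
  , (⌞⌝⇒Helly , λ ⊇ → frame∉[⌞⌜⌝] (widen [ inj₁ , inj₂ ∘ inj₂ ]′ (⊇ frame∈Helly)))
  , ((λ ⊆ → frame∉[⌞⌜⌝] (widen [ inj₁ , inj₂ ∘ inj₁ ]′ (⊆ frame∈Helly)))
    , λ ⊆ → sun∉Helly (⊆ sun∈[⌞⌜]))
  , ((λ ⊆ → frame∉[⌞⌜⌝] (⊆ frame∈Helly))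
    , λ ⊆ → sun∉Helly (⊆ (widen [ inj₁ , inj₂ ∘ inj₁ ]′ sun∈[⌞⌜])))
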